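{- For an integer $k\ge 1$, let ${\cal D}_n^k$ be the hypergraph on vertex set $E(K_n)$ whose hyperedges are the edge sets of all graphs on the vertex set of $K_n$ which are not $k$-degenerate, and let $e(n)=(n-k)k+\binom{k}{2}$. If $k=k(n)=o(\log n)$, then (for all sufficiently large $n$) $\tau_E({\cal D}_n^k)=e(n)+1$.
   Context: A graph $G$ is $k$-degenerate if every subgraph of $G$ has a vertex of degree at most $k$; a $k$-degenerate graph on $n$ vertices has at most $e(n)$ edges. Avoider-Enforcer game on a hypergraph ${\cal F}$ with vertex set (board) $E(K_n)$: two players, Avoider and Enforcer, alternately claim previously unclaimed edges of $K_n$, one edge per move, Avoider moving first, until all edges are claimed. Enforcer wins if at some point the set of edges claimed by Avoider contains all elements of some hyperedge (losing set) of ${\cal F}$; otherwise Avoider wins. $\tau_E({\cal F})$ denotes the smallest integer $t$ such that Enforcer has a strategy to win the game ${\cal F}$ in at most $t$ moves (i.e., forcing Avoider to complete a losing set within his first $t$ moves), with $\tau_E({\cal F})=\infty$ if the game is an Avoider's win. $\log$ is the natural logarithm. -}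

module Defs where

open import Data.Nat using (ℕ; zero; suc; _+_; _*_; _∸_; _^_; _≤_; _<_)
open import Data.Nat.Combinatorics using (_C_)
open import Data.Fin using (Fin; _≟_) renaming (_<_ to _<ᶠ_)
open import Data.Fin.Properties using (<-cmp)
open import Data.Bool using (Bool; true; false; _∨_; _∧_; if_then_else_)
open import Data.List using (List; map; allFin)
open import Data.Nat.ListAction using (sum)
open import Data.Product using (Σ; ∃; _×_; _,_; proj₁; proj₂)
open import Data.Sum using (_⊎_)
open import Relation.Nullary using (¬_)
open import Relation.Nullary.Decidable using (⌊_⌋)
open import Relation.Binary.PropositionalEquality using (_≡_)
open import Relation.Binary.Definitions using (tri<; tri≈; tri>)

Edge : ℕ → Set
Edge n = Σ (Fin n × Fin n) (λ p → proj₁ p <ᶠ proj₂ p)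

src tgt : ∀ {n} → Edge n → Fin n
src e = proj₁ (proj₁ e)
tgt e = proj₂ (proj₁ e)

Graph : ℕ → Set
Graph n = Edge n → Bool

∅ : ∀ {n} → Graph n
∅ _ = false

_⊆ᴳ_ : ∀ {n} → Graph n → Graph n → Set
H ⊆ᴳ G = ∀ e → H e ≡ true → G e ≡ true

sameEdge : ∀ {n} → Edge n → Edge n → Bool
sameEdge e e' = ⌊ src e ≟ src e' ⌋ ∧ ⌊ tgt e ≟ tgt e' ⌋

insert : ∀ {n} → Edge n → Graph n → Graph n
insert e G e' = G e' ∨ sameEdge e e'

adj : ∀ {n} → Graph n → Fin n → Fin n → Bool
adj G u v with <-cmp u v
... | tri< u<v _ _ = G ((u , v) , u<v)
... | tri≈ _ _ _   = false
... | tri> _ _ v<u = G ((v , u) , v<u)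

deg : ∀ {n} → Graph n → Fin n → ℕ
deg {n} G v = sum (map (λ u → if adj G u v then 1 else 0) (allFin n))

Degenerate : ∀ {n} → ℕ → Graph n → Set
Degenerate {n} k G =
  (S : Fin n → Bool) (H : Graph n) →
  (∃ λ v → S v ≡ true) →
  H ⊆ᴳ G →
  (∀ e → H e ≡ true → (S (src e) ≡ true) × (S (tgt e) ≡ true)) →
  ∃ λ v → (S v ≡ true) × (deg H v ≤ k)

Hypergraph : ℕ → Set₁
Hypergraph n = Graph n → Set

𝒟 : (n k : ℕ) → Hypergraph n
𝒟 n k F = ¬ Degenerate k F

Contains : ∀ {n} → Hypergraph n → Graph n → Set
Contains L A = ∃ λ F → L F × (F ⊆ᴳ A)

Free : ∀ {n} → Graph n → Graph n → Edge n → Set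
Free A B e = (A e ≡ false) × (B e ≡ false)

-- Force L t A B : in the position where Avoider owns A, Enforcer owns B and
-- Avoider is to move, Enforcer can force Avoider to own a losing set within
-- Avoider's next t moves.
Force : ∀ {n} → Hypergraph n → ℕ → Graph n → Graph n → Set
Force L zero A B = Contains L A
Force L (suc t) A B =
  Contains L A ⊎
  ((∃ λ e → Free A B e) ×
   (∀ e → Free A B e →
     Contains L (insert e A) ⊎
     (∃ λ e' → Free (insert e A) B e' × Force L t (insert e A) (insert e' B))))

TauE≡ : ∀ {n} → Hypergraph n → ℕ → Set
TauE≡ L t = Force L t ∅ ∅ × (∀ s → s < t → ¬ Force L s ∅ ∅)

eBound : ℕ → ℕ → ℕ
eBound n k = (n ∸ k) * k + k C 2

-- k(n) = o(log n): for every m, eventually m * k(n) ≤ log₂ n, i.e. 2^(m k(n)) ≤ n.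
-- (The base of the logarithm is irrelevant for o(·).)
LittleOLog : (ℕ → ℕ) → Set
LittleOLog k = ∀ m → ∃ λ N → ∀ n → N ≤ n → 2 ^ (m * k n) ≤ n

{-# OPTIONS --safe #-}
module Submission where

-- Enforcer needs no strategy: a k-degenerate graph has at most e(n) edges, and the board
-- is large enough for Avoider to be made to claim e(n) + 1 of them.
--
-- Avoider, in turn, never wastes a move: he builds a k-degenerate graph with exactly e(n)
-- edges. He first chooses hubs h₁, …, h_k one at a time, each among the common neighbours
-- of the previous ones, and joins each to a constant fraction of the remaining candidates;
-- this takes 2^O(k) moves and leaves k further vertices c₁, …, c_k joined to all hubs.
-- As n is much larger, there are 2k vertices y₁, …, y_2k that neither player has touched.
-- From here on he plays a pairing strategy: each yⱼ gets one edge of every pair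
-- {yⱼ hᵢ, yⱼ cᵢ}, and each other vertex x gets one edge of as many pairs
-- {x yᵢ, x y_{k+i}} as it needs to have k back-neighbours.

open import Defs
open import Data.Nat
  using (ℕ; zero; suc; _+_; _*_; _∸_; _^_; _⊓_; _≤_; _<_; z≤n; s≤s; _≤?_)
open import Data.Nat.Properties hiding (_≟_; <-cmp; <-irrelevant)
open import Data.Nat.Combinatorics using (_C_; nCk+nC[k+1]≡[n+1]C[k+1]; nC1≡n)
open import Data.Nat.ListAction using (sum)
open import Data.Nat.ListAction.Properties using (sum-++; sum-↭)
open import Data.Nat.Tactic.RingSolver using (solve-∀)
open import Data.Fin using (Fin; _≟_)
open import Data.Fin.Properties using (<-cmp; <-irrelevant)
open import Data.Bool using (Bool; true; false; if_then_else_; _∧_)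
open import Data.List
  using (List; []; _∷_; _++_; length; map; filter; allFin; concatMap; take; zip)
open import Data.List.Properties
  using (length-++; length-map; length-take; length-zipWith; length-tabulate; map-++; map-∘; map-cong; filter-notAll)
open import Data.List.Relation.Unary.All using (All; []; _∷_)
import Data.List.Relation.Unary.All as All
import Data.List.Relation.Unary.All.Properties as All
open import Data.List.Relation.Unary.Any using (Any; here; there)
import Data.List.Relation.Unary.Any as Any
import Data.List.Relation.Unary.Any.Properties as Any
open import Data.List.Relation.Unary.AllPairs using (AllPairs; []; _∷_)
import Data.List.Relation.Unary.AllPairs as AllPairs
import Data.List.Relation.Unary.AllPairs.Properties as AllPairs
open import Data.List.Relation.Unary.Unique.Propositional using (Unique)
import Data.List.Relation.Unary.Unique.Propositional.Properties as Unique
open import Data.List.Membership.Propositional using (_∈_; _∉_)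
open import Data.List.Membership.Propositional.Properties
  using (∈-allFin; ∈-filter⁺; ∈-filter⁻; ∈-++⁺ˡ; ∈-++⁺ʳ; ∈-++⁻)
import Data.List.Membership.DecPropositional as DecMembership
open import Data.List.Relation.Binary.Permutation.Propositional
  using (_↭_; ↭-refl; ↭-prep; ↭-swap; ↭-trans; ↭⇒↭ₛ)
open import Data.List.Relation.Binary.Permutation.Propositional.Properties
  using (All-resp-↭; ↭-length; map⁺)
import Data.List.Relation.Binary.Permutation.Setoid.Properties as Permutation
open import Data.Product using (Σ; ∃; _×_; _,_; proj₁; proj₂)
open import Data.Sum using (_⊎_; inj₁; inj₂; [_,_]′)
import Data.Sum as Sum
import Data.Bool as Bool
open import Function using (_∘_; id)
open import Relation.Nullary using (¬_; Dec; yes; no; contradiction; ¬?)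
open import Relation.Nullary.Decidable using (⌊_⌋; _×-dec_; _⊎-dec_)
open import Relation.Unary using (Decidable)
open import Relation.Binary.PropositionalEquality
  using (_≡_; _≢_; refl; sym; trans; cong; cong₂; subst; subst₂; resp₂; setoid; module ≡-Reasoning)
open import Relation.Binary.Definitions using (tri<; tri≈; tri>)

-- A `k`-degenerate graph with exactly `e(n)` edges has a clique on the first `k` vertices of its
-- ordering. A pairing strategy cannot deliver a prescribed clique, as it secures only one edge of
-- each pair; so the hubs are chosen adaptively, while Enforcer's claims are too few to be dense at
-- every candidate. Meanwhile Enforcer may cut other vertices off from the hubs, so these are
-- attached to the reserve vertices instead, all of whose edges are still free. A reserve vertex
-- needs `k` earlier neighbours of its own, hence `2k` options below it: the `k` hubs and the `k`
-- vertices `cᵢ`, which already have their `k` neighbours and require nothing more. The ordering is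
-- thus hubs, `cᵢ`, reserve, rest, and every pair of options points strictly down. A constant factor
-- of the candidates is lost per hub, so the hub phase may take up to `2 * 16 ^ k` moves; this is
-- where the bound on `k` against `log n` enters.

private variable
  n : ℕ
  A : Set

_∈?_ : (v : Fin n) (vs : List (Fin n)) → Dec (v ∈ vs)
_∈?_ = DecMembership._∈?_ _≟_

-- Double counting in lists of vertices

sumOver : List A → (A → ℕ) → ℕ
sumOver xs f = sum (map f xs)

sumOver-+ : (xs : List A) (f g : A → ℕ) →
  sumOver xs (λ x → f x + g x) ≡ sumOver xs f + sumOver xs g
sumOver-+ []       f g = refl
sumOver-+ (x ∷ xs) f g = trans (cong (f x + g x +_) (sumOver-+ xs f g))
  (interchange (f x) (g x) (sumOver xs f) (sumOver xs g))
  where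
  interchange : ∀ a b c d → a + b + (c + d) ≡ a + c + (b + d)
  interchange = solve-∀

sumOver-++ : (xs ys : List A) (f : A → ℕ) →
  sumOver (xs ++ ys) f ≡ sumOver xs f + sumOver ys f
sumOver-++ xs ys f = trans (cong sum (map-++ f xs ys)) (sum-++ (map f xs) (map f ys))

sumOver-mono : (xs : List A) {f g : A → ℕ} →
  (∀ x → x ∈ xs → f x ≤ g x) → sumOver xs f ≤ sumOver xs g
sumOver-mono []       f≤g = z≤n
sumOver-mono (x ∷ xs) f≤g =
  +-mono-≤ (f≤g x (here refl)) (sumOver-mono xs (λ y y∈ → f≤g y (there y∈)))

sumOver-const : (xs : List A) (c : ℕ) → sumOver xs (λ _ → c) ≡ length xs * c
sumOver-const []       c = refl
sumOver-const (x ∷ xs) c = cong (c +_) (sumOver-const xs c)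

sumOver-small : (xs : List A) (f : A → ℕ) {d : ℕ} →
  sumOver xs f < length xs * suc d → ∃ λ x → x ∈ xs × f x ≤ d
sumOver-small (x ∷ xs) f {d} lt with f x ≤? d
... | yes fx≤d = x , here refl , fx≤d
... | no  fx≰d =
  let y , y∈ , fy≤d = sumOver-small xs f (+-cancelˡ-< (suc d) _ _
                        (≤-<-trans (+-monoˡ-≤ _ (≰⇒> fx≰d)) lt))
  in y , there y∈ , fy≤d

δ : Fin n → Fin n → ℕ
δ v x = if ⌊ v ≟ x ⌋ then 1 else 0

count : Fin n → List (Fin n) → ℕ
count v xs = sumOver xs (δ v)

δ-refl : (v : Fin n) → δ v v ≡ 1
δ-refl v with v ≟ v
... | yes _   = refl
... | no v≢v = contradiction refl v≢v

δ-≢ : {v x : Fin n} → v ≢ x → δ v x ≡ 0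
δ-≢ {v = v} {x} v≢x with v ≟ x
... | yes v≡x = contradiction v≡x v≢x
... | no _    = refl

∈⇒1≤count : {v : Fin n} {xs : List (Fin n)} → v ∈ xs → 1 ≤ count v xs
∈⇒1≤count {v = v} (here refl) = ≤-trans (≤-reflexive (sym (δ-refl v))) (m≤m+n _ _)
∈⇒1≤count (there v∈) = ≤-trans (∈⇒1≤count v∈) (m≤n+m _ _)

Σδ≡0 : (L : List (Fin n)) {x : Fin n} → All (x ≢_) L → sumOver L (λ v → δ v x) ≡ 0
Σδ≡0 []       []          = refl
Σδ≡0 (v ∷ L) (x≢v ∷ x≢) = cong₂ _+_ (δ-≢ (x≢v ∘ sym)) (Σδ≡0 L x≢)

Σδ≤1 : {L : List (Fin n)} → Unique L → (x : Fin n) → sumOver L (λ v → δ v x) ≤ 1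
Σδ≤1 []                     x = z≤n
Σδ≤1 {L = v ∷ L} (v∉L ∷ uL) x with v ≟ x
... | yes refl = ≤-reflexive (cong suc (Σδ≡0 L v∉L))
... | no _     = Σδ≤1 uL x

-- Exchange of summation: an entry of `xs` is counted by at most one vertex of `L`. Degree bounds,
-- averaging and the final edge count all reduce to this inequality.
Σcount≤length : {L : List (Fin n)} → Unique L → (xs : List (Fin n)) →
  sumOver L (λ v → count v xs) ≤ length xs
Σcount≤length {L = L} uL [] =
  ≤-reflexive (trans (sumOver-const L 0) (*-zeroʳ (length L)))
Σcount≤length {L = L} uL (x ∷ xs) = begin
  sumOver L (λ v → δ v x + count v xs)
    ≡⟨ sumOver-+ L (λ v → δ v x) (λ v → count v xs) ⟩
  sumOver L (λ v → δ v x) + sumOver L (λ v → count v xs)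
    ≤⟨ +-mono-≤ (Σδ≤1 uL x) (Σcount≤length uL xs) ⟩
  suc (length xs) ∎
  where open ≤-Reasoning

-- Averaging. It serves twice: to find a vertex that still has a free edge, and to find a candidate
-- at which Enforcer has claimed few edges, the next hub.
rare : {L : List (Fin n)} → Unique L → (xs : List (Fin n)) {d : ℕ} →
  length xs < length L * suc d → ∃ λ v → v ∈ L × count v xs ≤ d
rare {L = L} uL xs lt =
  sumOver-small L (λ v → count v xs) (≤-<-trans (Σcount≤length uL xs) lt)

unique-⊆⇒length≤ : {L T : List (Fin n)} → Unique L → (∀ v → v ∈ L → v ∈ T) →
  length L ≤ length T
unique-⊆⇒length≤ {L = L} {T} uL L⊆T = begin
  length L                       ≡⟨ *-identityʳ (length L) ⟨
  length L * 1                   ≡⟨ sumOver-const L 1 ⟨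
  sumOver L (λ _ → 1)            ≤⟨ sumOver-mono L (λ v v∈ → ∈⇒1≤count (L⊆T v v∈)) ⟩
  sumOver L (λ v → count v T)    ≤⟨ Σcount≤length uL T ⟩
  length T                       ∎
  where open ≤-Reasoning

length-filter-split : {P : A → Set} (P? : Decidable P) (xs : List A) →
  length xs ≡ length (filter P? xs) + length (filter (¬? ∘ P?) xs)
length-filter-split P? [] = refl
length-filter-split P? (x ∷ xs) with P? x
... | yes _ = cong suc (length-filter-split P? xs)
... | no _  = trans (cong suc (length-filter-split P? xs)) (sym (+-suc _ _))

infixl 5 _∖_
_∖_ : List (Fin n) → List (Fin n) → List (Fin n)
L ∖ T = filter (¬? ∘ (_∈? T)) L

∈-∖⁻ : {v : Fin n} (L T : List (Fin n)) → v ∈ L ∖ T → v ∈ L × v ∉ T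
∈-∖⁻ L T = ∈-filter⁻ (¬? ∘ (_∈? T)) {xs = L}

∖-unique : {L : List (Fin n)} (T : List (Fin n)) → Unique L → Unique (L ∖ T)
∖-unique T = Unique.filter⁺ (¬? ∘ (_∈? T))

length-∖ : {L : List (Fin n)} (T : List (Fin n)) → Unique L →
  length L ≤ length T + length (L ∖ T)
length-∖ {L = L} T uL = begin
  length L                                          ≡⟨ length-filter-split (_∈? T) L ⟩
  length (filter (_∈? T) L) + length (L ∖ T)        ≤⟨ +-monoˡ-≤ _ (unique-⊆⇒length≤
                                                        (Unique.filter⁺ (_∈? T) uL)
                                                        (λ v v∈ → proj₂ (∈-filter⁻ (_∈? T) {xs = L} v∈))) ⟩
  length T + length (L ∖ T)                         ∎
  where open ≤-Reasoning

length-allFin : ∀ n → length (allFin n) ≡ n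
length-allFin n = length-tabulate {n = n} id

length-take-≤ : {m : ℕ} (xs : List A) → m ≤ length xs → length (take m xs) ≡ m
length-take-≤ {m = m} xs m≤ = trans (length-take m xs) (m≤n⇒m⊓n≡m m≤)

∈-take : {x : A} (m : ℕ) {xs : List A} → x ∈ take m xs → x ∈ xs
∈-take (suc m) {_ ∷ _} (here refl) = here refl
∈-take (suc m) {_ ∷ _} (there x∈)  = there (∈-take m x∈)

fresh : (m : ℕ) (T : List (Fin n)) → length T + m ≤ n →
  ∃ λ L → Unique L × length L ≡ m × (∀ v → v ∈ L → v ∉ T)
fresh {n = n} m T T+m≤n =
    take m rest
  , Unique.take⁺ m (∖-unique T (Unique.allFin⁺ n))
  , length-take-≤ rest (+-cancelˡ-≤ (length T) _ _ (≤-trans T+m≤n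
      (≤-trans (≤-reflexive (sym (length-allFin n))) (length-∖ T (Unique.allFin⁺ n)))))
  , λ v v∈ → proj₂ (∈-∖⁻ (allFin n) T (∈-take m v∈))
  where rest = allFin n ∖ T
-- Edges as unordered pairs; degenerate graphs

Pair : ℕ → Set
Pair n = Fin n × Fin n

infix 4 _∼_
_∼_ : Pair n → Pair n → Set
(v , u) ∼ (x , y) = (v ≡ x × u ≡ y) ⊎ (v ≡ y × u ≡ x)

∼-refl : {p : Pair n} → p ∼ p
∼-refl = inj₁ (refl , refl)

∼-sym : {p q : Pair n} → p ∼ q → q ∼ p
∼-sym (inj₁ (refl , refl)) = inj₁ (refl , refl)
∼-sym (inj₂ (refl , refl)) = inj₂ (refl , refl)

∼-trans : {p q r : Pair n} → p ∼ q → q ∼ r → p ∼ r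
∼-trans (inj₁ (refl , refl)) q∼r                  = q∼r
∼-trans (inj₂ (refl , refl)) (inj₁ (refl , refl)) = inj₂ (refl , refl)
∼-trans (inj₂ (refl , refl)) (inj₂ (refl , refl)) = inj₁ (refl , refl)

∼-flip : {u v : Fin n} → (u , v) ∼ (v , u)
∼-flip = inj₂ (refl , refl)

_∼?_ : (p q : Pair n) → Dec (p ∼ q)
(v , u) ∼? (x , y) = (v ≟ x ×-dec u ≟ y) ⊎-dec (v ≟ y ×-dec u ≟ x)

edge-≡ : (e e' : Edge n) → proj₁ e ≡ proj₁ e' → e ≡ e'
edge-≡ (p , lt) (.p , lt') refl = cong (p ,_) (<-irrelevant lt lt')

edge-≢ : (e : Edge n) → src e ≢ tgt e
edge-≢ ((u , v) , u<v) u≡v with <-cmp u v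
... | tri< _ u≢v _ = u≢v u≡v
... | tri≈ u≮v _ _ = u≮v u<v
... | tri> _ u≢v _ = u≢v u≡v

edge-∼ : (e e' : Edge n) → proj₁ e ∼ proj₁ e' → e ≡ e'
edge-∼ e e' (inj₁ (refl , refl)) = edge-≡ e e' refl
edge-∼ ((u , v) , u<v) (_ , v<u) (inj₂ (refl , refl)) with <-cmp u v
... | tri< _ _ v≮u = contradiction v<u v≮u
... | tri≈ _ _ v≮u = contradiction v<u v≮u
... | tri> u≮v _ _ = contradiction u<v u≮v

edge : (u v : Fin n) → u ≢ v → Σ (Edge n) λ e → proj₁ e ∼ (u , v)
edge u v u≢v with <-cmp u v
... | tri< u<v _ _ = ((u , v) , u<v) , ∼-refl
... | tri≈ _ u≡v _ = contradiction u≡v u≢v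
... | tri> _ _ v<u = ((v , u) , v<u) , ∼-flip

adj⇒edge : (G : Graph n) (u v : Fin n) → adj G u v ≡ true →
  Σ (Edge n) λ e → G e ≡ true × proj₁ e ∼ (u , v)
adj⇒edge G u v eq with <-cmp u v
... | tri< u<v _ _ = ((u , v) , u<v) , eq , ∼-refl
... | tri> _ _ v<u = ((v , u) , v<u) , eq , ∼-flip

edge⇒adj : (G : Graph n) (e : Edge n) (u v : Fin n) → G e ≡ true →
  proj₁ e ∼ (u , v) → adj G u v ≡ true
edge⇒adj G e u v Ge e∼ with <-cmp u v
... | tri< u<v _ _ = subst (λ x → G x ≡ true) (edge-∼ e ((u , v) , u<v) e∼) Ge
... | tri> _ _ v<u = subst (λ x → G x ≡ true) (edge-∼ e ((v , u) , v<u) (∼-trans e∼ ∼-flip)) Ge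
... | tri≈ _ refl _ with e∼
...   | inj₁ (refl , refl) = contradiction refl (edge-≢ e)
...   | inj₂ (refl , refl) = contradiction refl (edge-≢ e)

sameEdge⇒≡ : (e e' : Edge n) → sameEdge e e' ≡ true → e ≡ e'
sameEdge⇒≡ e e' eq with src e ≟ src e' | tgt e ≟ tgt e'
... | yes s | yes t = edge-≡ e e' (cong₂ _,_ s t)

sameEdge-refl : (e : Edge n) → sameEdge e e ≡ true
sameEdge-refl e with src e ≟ src e | tgt e ≟ tgt e
... | yes _ | yes _ = refl
... | no s≢ | _     = contradiction refl s≢
... | yes _ | no t≢ = contradiction refl t≢

insert⁻ : (e : Edge n) (G : Graph n) (x : Edge n) → insert e G x ≡ true → G x ≡ true ⊎ e ≡ x
insert⁻ e G x eq with G x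
... | true  = inj₁ refl
... | false = inj₂ (sameEdge⇒≡ e x eq)

insert-⊇ : (e : Edge n) (G : Graph n) → G ⊆ᴳ insert e G
insert-⊇ e G x Gx rewrite Gx = refl

insert-∈ : (e : Edge n) (G : Graph n) → insert e G e ≡ true
insert-∈ e G with G e
... | true  = refl
... | false = sameEdge-refl e

hit : Fin n → Fin n → Fin n → List (Fin n) → List (Fin n)
hit v x y us with v ≟ x
... | yes _ = y ∷ us
... | no _  = us

hit-length : (v x y : Fin n) (us : List (Fin n)) → length (hit v x y us) ≡ δ v x + length us
hit-length v x y us with v ≟ x
... | yes _ = refl
... | no _  = refl

hit-here : (v y : Fin n) (us : List (Fin n)) → y ∈ hit v v y us
hit-here v y us with v ≟ v
... | yes _   = here refl
... | no v≢v = contradiction refl v≢v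

hit-there : {u : Fin n} (v x y : Fin n) {us : List (Fin n)} → u ∈ us → u ∈ hit v x y us
hit-there v x y u∈ with v ≟ x
... | yes _ = there u∈
... | no _  = u∈

hit⁻ : {u : Fin n} (v x y : Fin n) {us : List (Fin n)} →
  u ∈ hit v x y us → (v ≡ x × u ≡ y) ⊎ u ∈ us
hit⁻ v x y u∈ with v ≟ x
hit⁻ v x y (here refl) | yes v≡x = inj₁ (v≡x , refl)
hit⁻ v x y (there u∈)  | yes _   = inj₂ u∈
hit⁻ v x y u∈          | no _    = inj₂ u∈

-- Repetitions are kept, so that the lengths are exactly the multiplicities of `v` in `tops` and
-- `ends`.
outNbrs nbrs : Fin n → List (Pair n) → List (Fin n)
outNbrs v []             = []
outNbrs v ((x , y) ∷ qs) = hit v x y (outNbrs v qs)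
nbrs v []             = []
nbrs v ((x , y) ∷ qs) = hit v x y (hit v y x (nbrs v qs))

tops ends : List (Pair n) → List (Fin n)
tops = map proj₁
ends []             = []
ends ((x , y) ∷ qs) = x ∷ y ∷ ends qs

length-ends : (qs : List (Pair n)) → length (ends qs) ≡ length qs + length qs
length-ends []       = refl
length-ends (q ∷ qs) = cong suc (trans (cong suc (length-ends qs)) (sym (+-suc _ _)))

length-outNbrs : (v : Fin n) (qs : List (Pair n)) → length (outNbrs v qs) ≡ count v (tops qs)
length-outNbrs v []             = refl
length-outNbrs v ((x , y) ∷ qs) =
  trans (hit-length v x y _) (cong (δ v x +_) (length-outNbrs v qs))

length-nbrs : (v : Fin n) (qs : List (Pair n)) → length (nbrs v qs) ≡ count v (ends qs)
length-nbrs v []             = refl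
length-nbrs v ((x , y) ∷ qs) = trans (hit-length v x y _)
  (cong (δ v x +_) (trans (hit-length v y x _) (cong (δ v y +_) (length-nbrs v qs))))

∈-outNbrs : {v u : Fin n} {qs : List (Pair n)} → (v , u) ∈ qs → u ∈ outNbrs v qs
∈-outNbrs {v = v} (here refl)                  = hit-here v _ _
∈-outNbrs {v = v} {qs = (x , y) ∷ _} (there p) = hit-there v x y (∈-outNbrs p)

∈-nbrs⁺ : {v u : Fin n} {qs : List (Pair n)} → Any ((v , u) ∼_) qs → u ∈ nbrs v qs
∈-nbrs⁺ {v = v} (here (inj₁ (refl , refl)))  = hit-here v _ _
∈-nbrs⁺ {v = v} {u} (here (inj₂ (refl , refl))) = hit-there v u v (hit-here v _ _)
∈-nbrs⁺ {v = v} {qs = (x , y) ∷ _} (there p) = hit-there v x y (hit-there v y x (∈-nbrs⁺ p))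

∈-nbrs⁻ : {v u : Fin n} (qs : List (Pair n)) → u ∈ nbrs v qs → Any ((v , u) ∼_) qs
∈-nbrs⁻ {v = v} ((x , y) ∷ qs) u∈ with hit⁻ v x y u∈
... | inj₁ v,u≡x,y = here (inj₁ v,u≡x,y)
... | inj₂ u∈' with hit⁻ v y x u∈'
...   | inj₁ v,u≡y,x = here (inj₂ v,u≡y,x)
...   | inj₂ u∈″     = there (∈-nbrs⁻ qs u∈″)

∈-ends : {v u : Fin n} {qs : List (Pair n)} → Any ((v , u) ∼_) qs → v ∈ ends qs × u ∈ ends qs
∈-ends (here (inj₁ (refl , refl))) = here refl , there (here refl)
∈-ends (here (inj₂ (refl , refl))) = there (here refl) , here refl
∈-ends (there p) = let v∈ , u∈ = ∈-ends p in there (there v∈) , there (there u∈)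

Any-∼-resp : {p q : Pair n} {qs : List (Pair n)} → p ∼ q → Any (p ∼_) qs → Any (q ∼_) qs
Any-∼-resp p∼q = Any.map (∼-trans (∼-sym p∼q))

indicator : Bool → ℕ
indicator b = if b then 1 else 0

deg-≤ : (G : Graph n) (v : Fin n) (T : List (Fin n)) →
  (∀ u → adj G u v ≡ true → u ∈ T) → deg G v ≤ length T
deg-≤ {n = n} G v T adj⇒∈ = ≤-trans
  (sumOver-mono (allFin n) (λ u _ → bound u (adj G u v) (adj⇒∈ u)))
  (Σcount≤length (Unique.allFin⁺ n) T)
  where
  bound : ∀ u b → (b ≡ true → u ∈ T) → indicator b ≤ count u T
  bound u true  u∈ = ∈⇒1≤count (u∈ refl)
  bound u false _  = z≤n

length-filter-true : (f : A → Bool) (xs : List A) →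
  length (filter (λ x → f x Bool.≟ true) xs) ≡ sumOver xs (indicator ∘ f)
length-filter-true f [] = refl
length-filter-true f (x ∷ xs) with f x
... | true  = cong suc (length-filter-true f xs)
... | false = length-filter-true f xs

deg-≥ : (G : Graph n) (v : Fin n) {us : List (Fin n)} → Unique us →
  (∀ u → u ∈ us → adj G u v ≡ true) → length us ≤ deg G v
deg-≥ {n = n} G v u! ∈⇒adj = ≤-trans
  (unique-⊆⇒length≤ u! (λ u u∈ → ∈-filter⁺ (λ x → adj G x v Bool.≟ true) (∈-allFin u) (∈⇒adj u u∈)))
  (≤-reflexive (length-filter-true (λ u → adj G u v) (allFin n)))

-- Only an upper bound on `G`: absence from `qs` proves an edge unclaimed, and degeneracy passes to
-- subgraphs. The lower bound that Enforcer's edge count needs is carried separately.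
Covers : Graph n → List (Pair n) → Set
Covers G qs = ∀ e → G e ≡ true → Any (proj₁ e ∼_) qs

maximal : (ρ : Fin n → ℕ) (S : Fin n → Bool) → (∃ λ v → S v ≡ true) →
  ∃ λ v → S v ≡ true × (∀ u → S u ≡ true → ρ u ≤ ρ v)
maximal {n = n} ρ S (v₀ , Sv₀) =
  let v , Sv , max = go (allFin n) in v , Sv , λ u → max u (∈-allFin u)
  where
  go : ∀ L → ∃ λ v → S v ≡ true × (∀ u → u ∈ L → S u ≡ true → ρ u ≤ ρ v)
  go []      = v₀ , Sv₀ , λ _ ()
  go (x ∷ L) with go L | S x in Sx
  ... | v , Sv , max | false = v , Sv , λ where
    u (here refl) Su → contradiction (trans (sym Su) Sx) (λ ())
    u (there u∈)  Su → max u u∈ Su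
  ... | v , Sv , max | true with ≤-total (ρ x) (ρ v)
  ...   | inj₁ ρx≤ρv = v , Sv , λ where
    u (here refl) _  → ρx≤ρv
    u (there u∈)  Su → max u u∈ Su
  ...   | inj₂ ρv≤ρx = x , Sx , λ where
    u (here refl) _  → ≤-refl
    u (there u∈)  Su → ≤-trans (max u u∈ Su) ρv≤ρx

-- The ordering may have ties, since strictness is asked only along listed pairs; in the
-- applications all vertices not yet placed share the top position.
Descending : (Fin n → ℕ) → List (Pair n) → Set
Descending ρ = All (λ p → ρ (proj₂ p) < ρ (proj₁ p))

-- A vertex of `S` with maximal `ρ` has no neighbour in `S` above it, so each of its edges in `H` is
-- one of its own at most `k` out-pairs.
descending⇒degenerate : ∀ {k} (ρ : Fin n → ℕ) {as : List (Pair n)} → Descending ρ as →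
  (∀ v → count v (tops as) ≤ k) → (G : Graph n) → Covers G as → Degenerate k G
descending⇒degenerate {n = n} ρ {as} desc out≤k G G⊆as S H S≢∅ H⊆G H⊆S
  with maximal ρ S S≢∅
... | v , Sv , max = v , Sv , (begin
  deg H v                  ≤⟨ deg-≤ H v (outNbrs v as) adj⇒∈ ⟩
  length (outNbrs v as)    ≡⟨ length-outNbrs v as ⟩
  count v (tops as)        ≤⟨ out≤k v ⟩
  _                        ∎)
  where
  open ≤-Reasoning
  orient : ∀ {u} qs → Descending ρ qs → S u ≡ true → Any ((u , v) ∼_) qs → (v , u) ∈ qs
  orient {u} (_ ∷ _) (lt ∷ _) Su (here (inj₁ (refl , refl))) = contradiction lt (≤⇒≯ (max u Su))
  orient     (_ ∷ _) _        Su (here (inj₂ (refl , refl))) = here refl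
  orient     (_ ∷ qs) (_ ∷ d) Su (there p)                   = there (orient qs d Su p)

  S-end : ∀ e {u} → H e ≡ true → proj₁ e ∼ (u , v) → S u ≡ true
  S-end e He (inj₁ (refl , _)) = proj₁ (H⊆S e He)
  S-end e He (inj₂ (_ , refl)) = proj₂ (H⊆S e He)

  adj⇒∈ : ∀ u → adj H u v ≡ true → u ∈ outNbrs v as
  adj⇒∈ u uv =
    let e , He , e∼ = adj⇒edge H u v uv
    in ∈-outNbrs (orient as desc (S-end e He e∼) (Any-∼-resp e∼ (G⊆as e (H⊆G e He))))
-- Edge counts and Enforcer's strategy

-- The bound obtained by deleting one vertex of degree at most `k` at a time. Unlike `eBound` it
-- stays sharp below `k` vertices, so the induction can run down to the empty set.
maxEdges : ℕ → ℕ → ℕ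
maxEdges k zero    = 0
maxEdges k (suc m) = maxEdges k m + k ⊓ m

suc-C2 : ∀ m → suc m C 2 ≡ m C 2 + m
suc-C2 m = begin
  suc m C 2      ≡⟨ nCk+nC[k+1]≡[n+1]C[k+1] m 1 ⟨
  m C 1 + m C 2  ≡⟨ cong (_+ m C 2) (nC1≡n m) ⟩
  m + m C 2      ≡⟨ +-comm m (m C 2) ⟩
  m C 2 + m      ∎
  where open ≡-Reasoning

maxEdges≤C2 : ∀ k m → maxEdges k m ≤ m C 2
maxEdges≤C2 k zero    = z≤n
maxEdges≤C2 k (suc m) = ≤-trans
  (+-mono-≤ (maxEdges≤C2 k m) (m⊓n≤n k m)) (≤-reflexive (sym (suc-C2 m)))

maxEdges-+ : ∀ k j → maxEdges k (j + k) ≤ j * k + k C 2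
maxEdges-+ k zero    = maxEdges≤C2 k k
maxEdges-+ k (suc j) = begin
  maxEdges k (j + k) + k ⊓ (j + k)  ≤⟨ +-mono-≤ (maxEdges-+ k j) (m⊓n≤m k (j + k)) ⟩
  j * k + k C 2 + k                 ≡⟨ rearrange (j * k) (k C 2) k ⟩
  k + j * k + k C 2                 ∎
  where
  open ≤-Reasoning
  rearrange : ∀ a b c → a + b + c ≡ c + a + b
  rearrange = solve-∀

maxEdges≤eBound : ∀ {n k} → k ≤ n → maxEdges k n ≤ eBound n k
maxEdges≤eBound {n} {k} k≤n =
  subst (λ m → maxEdges k m ≤ eBound n k) (m∸n+n≡m k≤n) (maxEdges-+ k (n ∸ k))

Incident : Fin n → Edge n → Set
Incident v e = v ≡ src e ⊎ v ≡ tgt e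

incident? : (v : Fin n) (e : Edge n) → Dec (Incident v e)
incident? v e = (v ≟ src e) ⊎-dec (v ≟ tgt e)

pairs : List (Edge n) → List (Pair n)
pairs = map proj₁

∈-pairs⁻ : {p : Pair n} (es : List (Edge n)) → Any (p ∼_) (pairs es) →
  Σ (Edge n) λ e → e ∈ es × p ∼ proj₁ e
∈-pairs⁻ (e ∷ es) (here p∼e) = e , here refl , p∼e
∈-pairs⁻ (e ∷ es) (there p)  =
  let e' , e'∈ , p∼e' = ∈-pairs⁻ es p in e' , there e'∈ , p∼e'

other-∉ : {v u : Fin n} (e : Edge n) {es : List (Edge n)} → All (e ≢_) es →
  proj₁ e ∼ (v , u) → ∀ {w} → w ∈ nbrs v (pairs es) → u ≢ w
other-∉ e {es} e∉ e∼ w∈ refl with ∈-pairs⁻ es (∈-nbrs⁻ (pairs es) w∈)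
... | e' , e'∈ , p∼e' = All.lookup e∉ e'∈ (edge-∼ e e' (∼-trans e∼ p∼e'))

nbrs-unique : (v : Fin n) {es : List (Edge n)} → Unique es → Unique (nbrs v (pairs es))
nbrs-unique v [] = []
nbrs-unique v {e@((x , y) , _) ∷ es} (e∉ ∷ es!) with v ≟ x | v ≟ y
... | no _     | no _     = nbrs-unique v es!
... | yes refl | yes refl = contradiction refl (edge-≢ e)
... | yes refl | no _     = All.tabulate (other-∉ e e∉ ∼-refl) ∷ nbrs-unique v es!
... | no _     | yes refl = All.tabulate (other-∉ e e∉ ∼-flip) ∷ nbrs-unique v es!

avoiding : Fin n → List (Edge n) → List (Edge n)
avoiding v = filter (¬? ∘ incident? v)

length-avoiding : (v : Fin n) (es : List (Edge n)) →
  length es ≤ length (avoiding v es) + length (nbrs v (pairs es))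
length-avoiding v [] = z≤n
length-avoiding v (((x , y) , _) ∷ es) with length-avoiding v es | v ≟ x | v ≟ y
... | ih | no _  | no _  = s≤s ih
... | ih | no _  | yes _ = ≤-trans (s≤s ih) (≤-reflexive (sym (+-suc _ _)))
... | ih | yes _ | no _  = ≤-trans (s≤s ih) (≤-reflexive (sym (+-suc _ _)))
... | ih | yes _ | yes _ = ≤-trans (s≤s ih)
  (≤-trans (≤-reflexive (sym (+-suc _ _))) (+-monoʳ-≤ _ (n≤1+n _)))

true-∈ : {v : Fin n} (L : List (Fin n)) → ⌊ v ∈? L ⌋ ≡ true → v ∈ L
true-∈ {v = v} L eq with v ∈? L
... | yes v∈ = v∈

∈-true : {v : Fin n} {L : List (Fin n)} → v ∈ L → ⌊ v ∈? L ⌋ ≡ true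
∈-true {v = v} {L} v∈ with v ∈? L
... | yes _ = refl
... | no v∉ = contradiction v∈ v∉

EdgesWithin : Graph n → List (Fin n) → List (Edge n) → Set
EdgesWithin G L es = ∀ e → e ∈ es → G e ≡ true × src e ∈ L × tgt e ∈ L

induced : Graph n → List (Fin n) → Graph n
induced G L e = G e ∧ (⌊ src e ∈? L ⌋ ∧ ⌊ tgt e ∈? L ⌋)

induced-⊆ : (G : Graph n) (L : List (Fin n)) → induced G L ⊆ᴳ G
induced-⊆ G L e eq with G e
... | true = refl

induced-ends : (G : Graph n) (L : List (Fin n)) (e : Edge n) → induced G L e ≡ true →
  ⌊ src e ∈? L ⌋ ≡ true × ⌊ tgt e ∈? L ⌋ ≡ true
induced-ends G L e eq with G e | ⌊ src e ∈? L ⌋ | ⌊ tgt e ∈? L ⌋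
... | true | true | true = refl , refl

-- Induction on the vertices available: degeneracy of the graph induced on `L` supplies a `v` of
-- degree at most `k`, and the edges at `v` inject into its neighbours, of which there are also at
-- most `m`. Edges are counted by a duplicate-free list because a graph is a Boolean function.
degenerate⇒few-edges : ∀ {k} {G : Graph n} → Degenerate k G →
  ∀ m (L : List (Fin n)) → length L ≤ m →
  ∀ {es} → Unique es → EdgesWithin G L es → length es ≤ maxEdges k m
degenerate⇒few-edges degen m [] _ {[]} _ within = z≤n
degenerate⇒few-edges degen m [] _ {e ∷ _} _ within with within e (here refl)
... | _ , () , _
degenerate⇒few-edges {k = k} {G} degen (suc m) L@(w ∷ _) L≤1+m {es} es! within
  with degen (λ u → ⌊ u ∈? L ⌋) (induced G L) (w , ∈-true {L = L} (here refl))
         (induced-⊆ G L) (induced-ends G L)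
... | v , Lv , deg≤k = begin
  length es                                            ≤⟨ length-avoiding v es ⟩
  length (avoiding v es) + length (nbrs v (pairs es))  ≤⟨ +-mono-≤
                                                            (degenerate⇒few-edges degen m L' L'≤m
                                                              (Unique.filter⁺ (¬? ∘ incident? v) es!) within')
                                                            (⊓-glb nbrs≤k nbrs≤m) ⟩
  maxEdges k m + k ⊓ m                                 ∎
  where
  open ≤-Reasoning
  L' = filter (¬? ∘ (v ≟_)) L

  L'≤m : length L' ≤ m
  L'≤m = ≤-pred (≤-trans (filter-notAll (¬? ∘ (v ≟_)) L
           (Any.map (λ v≡u v≢u → v≢u v≡u) (true-∈ L Lv))) L≤1+m)

  nbr∈L : ∀ {u} → u ∈ nbrs v (pairs es) → u ∈ L' × adj (induced G L) u v ≡ true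
  nbr∈L {u} u∈ with ∈-pairs⁻ es (∈-nbrs⁻ (pairs es) u∈)
  ... | e , e∈ , v,u∼e with within e e∈
  ...   | Ge , src∈ , tgt∈ = end∈ v,u∼e , edge⇒adj (induced G L) e u v e-induced
                                           (∼-trans (∼-sym v,u∼e) ∼-flip)
    where
    e-induced : induced G L e ≡ true
    e-induced rewrite Ge | ∈-true src∈ | ∈-true tgt∈ = refl
    end∈ : (v , u) ∼ proj₁ e → u ∈ L'
    end∈ (inj₁ (refl , refl)) = ∈-filter⁺ (¬? ∘ (v ≟_)) tgt∈ (edge-≢ e)
    end∈ (inj₂ (refl , refl)) = ∈-filter⁺ (¬? ∘ (v ≟_)) src∈ (edge-≢ e ∘ sym)

  nbrs! = nbrs-unique v es!
  nbrs≤k : length (nbrs v (pairs es)) ≤ k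
  nbrs≤k = ≤-trans (deg-≥ (induced G L) v nbrs! (λ _ → proj₂ ∘ nbr∈L)) deg≤k
  nbrs≤m : length (nbrs v (pairs es)) ≤ m
  nbrs≤m = ≤-trans (unique-⊆⇒length≤ nbrs! (λ _ → proj₁ ∘ nbr∈L)) L'≤m

  within' : EdgesWithin G L' (avoiding v es)
  within' e e∈ with ∈-filter⁻ (¬? ∘ incident? v) {xs = es} e∈
  ... | e∈es , ¬inc with within e e∈es
  ...   | Ge , src∈ , tgt∈ = Ge , ∈-filter⁺ (¬? ∘ (v ≟_)) src∈ (¬inc ∘ inj₁)
                              , ∈-filter⁺ (¬? ∘ (v ≟_)) tgt∈ (¬inc ∘ inj₂)

unclaimed : (G : Graph n) {qs : List (Pair n)} (e : Edge n) →
  Covers G qs → ¬ Any (proj₁ e ∼_) qs → G e ≡ false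
unclaimed G e G⊆qs e∉ with G e in eq
... | false = refl
... | true  = contradiction (G⊆qs e eq) e∉

covers-insert : {G : Graph n} {qs : List (Pair n)} {p : Pair n} (e : Edge n) →
  Covers G qs → proj₁ e ∼ p → Covers (insert e G) (p ∷ qs)
covers-insert {G = G} e G⊆qs e∼p x Gx with insert⁻ e G x Gx
... | inj₁ Gx'  = there (G⊆qs x Gx')
... | inj₂ refl = here e∼p


-- The claims have fewer than `n * suc d` ends, so some vertex meets at most `d` of them and still
-- has a partner among the other vertices. For `d = n - 2` the hypothesis says that fewer than
-- `n C 2` claims were made.
free-edge : (A B : Graph n) {as bs : List (Pair n)} → Covers A as → Covers B bs →
  ∀ d → suc (suc d) ≤ n → (length as + length bs) + (length as + length bs) < n * suc d →
  ∃ λ e → Free A B e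
free-edge {n = n} A B {as} {bs} A⊆as B⊆bs d d+2≤n few
  with rare (Unique.allFin⁺ n) (ends (as ++ bs)) {d}
    (subst₂ _<_ (sym (trans (length-ends (as ++ bs)) (cong (λ l → l + l) (length-++ as))))
                (cong (_* suc d) (sym (length-allFin n))) few)
... | v , _ , count≤d
  with fresh 1 (v ∷ nbrs v (as ++ bs))
    (≤-trans (≤-reflexive (+-comm _ 1))
      (≤-trans (s≤s (s≤s (≤-trans (≤-reflexive (length-nbrs v (as ++ bs))) count≤d))) d+2≤n))
... | u ∷ [] , _ , _ , u∉ with u∉ u (here refl)
...   | u∉' with edge v u (λ v≡u → u∉' (here (sym v≡u)))
...     | e , e∼ = e , unclaimed A e A⊆as (u∉' ∘ there ∘ ∈-nbrs⁺ ∘ Any-∼-resp e∼ ∘ Any.++⁺ˡ)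
                     , unclaimed B e B⊆bs (u∉' ∘ there ∘ ∈-nbrs⁺ ∘ Any-∼-resp e∼ ∘ Any.++⁺ʳ as)


-- Any free edge is a good reply; only the supply of free edges has to be checked. The factor 4 is
-- two players times two ends per edge. At `t = 0` Avoider owns `eBound n k + 1` distinct edges, too
-- many for a `k`-degenerate graph.
enforcer-wins : ∀ {k} (d : ℕ) → k ≤ n → suc (suc d) ≤ n →
  4 * suc (eBound n k) < n * suc d →
  ∀ t {es bs} {A B : Graph n} → Unique es → (∀ e → e ∈ es → A e ≡ true) →
  Covers A (pairs es) → Covers B bs → length bs ≡ length es →
  t + length es ≡ suc (eBound n k) → Force (𝒟 n k) t A B
enforcer-wins {n = n} {k} d k≤n _ _ zero {es} {A = A} es! es⊆A _ _ _ total =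
  A , many-edges , λ _ → id
  where
  many-edges : ¬ Degenerate k A
  many-edges degen = <⇒≱ (≤-reflexive (sym total))
    (≤-trans (degenerate⇒few-edges degen n (allFin n) (≤-reflexive (length-allFin n)) es!
               (λ e e∈ → es⊆A e e∈ , ∈-allFin _ , ∈-allFin _))
             (maxEdges≤eBound k≤n))
enforcer-wins {n = n} {k} d k≤n d+2≤n small (suc t) {es} {bs} {A} {B} es! es⊆A A⊆ B⊆ |bs| total =
  inj₂ (free-edge A B A⊆ B⊆ d d+2≤n (few (≤-trans (≤-reflexive (length-map proj₁ es)) (n≤1+n _))) , reply)
  where
  -- `a` is the number of Avoider's claims: `length es` when he moves, one more when Enforcer
  -- replies.
  few : ∀ {a} → a ≤ suc (length es) → (a + length bs) + (a + length bs) < n * suc d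
  few {a} a≤ = ≤-<-trans (begin
    (a + length bs) + (a + length bs)  ≤⟨ +-mono-≤ step step ⟩
    (E + E) + (E + E)                  ≡⟨ four E ⟩
    4 * E                              ∎) small
    where
    open ≤-Reasoning
    E = suc (eBound n k)
    four : ∀ x → (x + x) + (x + x) ≡ 4 * x
    four = solve-∀
    es<E : suc (length es) ≤ E
    es<E = ≤-trans (s≤s (m≤n+m (length es) t)) (≤-reflexive total)
    step : a + length bs ≤ E + E
    step = +-mono-≤ (≤-trans a≤ es<E) (≤-trans (≤-reflexive |bs|) (≤-trans (n≤1+n _) es<E))

  reply : ∀ e → Free A B e → Contains (𝒟 n k) (insert e A) ⊎
    (∃ λ e' → Free (insert e A) B e' × Force (𝒟 n k) t (insert e A) (insert e' B))
  reply e (Ae , _) = inj₂ (e' , free' , enforcer-wins d k≤n d+2≤n small t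
      (All.tabulate (λ x∈ e≡x → contradiction
         (trans (sym (es⊆A _ x∈)) (trans (cong A (sym e≡x)) Ae)) (λ ())) ∷ es!)
      (λ where
        x (here refl) → insert-∈ e A
        x (there x∈)  → insert-⊇ e A x (es⊆A x x∈))
      A'⊆ (covers-insert e' B⊆ ∼-refl) (cong suc |bs|) (trans (+-suc t _) total))
    where
    A'⊆ = covers-insert {G = A} {qs = pairs es} e A⊆ ∼-refl
    found = free-edge (insert e A) B A'⊆ B⊆ d d+2≤n
              (few (≤-reflexive (cong suc (length-map proj₁ es))))
    e' = proj₁ found
    free' = proj₂ found

-- Avoider's strategies

-- Avoider is to move. A claimed pair (v , u) in as is oriented towards the neighbour u
-- that precedes v in the degeneracy ordering.
Survives : ℕ → ℕ → List (Pair n) → List (Pair n) → Set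
Survives {n} k t as bs =
  (A B : Graph n) → Covers A as → Covers B bs → ¬ Force (𝒟 n k) t A B

Safe : ℕ → List (Pair n) → Set
Safe {n} k as = (G : Graph n) → Covers G as → Degenerate k G

safe⇒¬contains : ∀ {k} {as : List (Pair n)} → Safe k as →
  {A : Graph n} → Covers A as → ¬ Contains (𝒟 n k) A
safe⇒¬contains safe A⊆ (F , ¬degen , F⊆A) = ¬degen (safe F (λ e Fe → A⊆ e (F⊆A e Fe)))

survives-zero : ∀ {k} {as bs : List (Pair n)} → Safe k as → Survives k 0 as bs
survives-zero safe A B A⊆ B⊆ = safe⇒¬contains safe A⊆

-- The single place where a round of `Force` is opened on Avoider's side. Enforcer's reply enters as
-- an arbitrary pair `f`, so the strategies below reason about lists of pairs alone.
survives-suc : ∀ {k t} {as bs : List (Pair n)} → Safe k as →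
  (v u : Fin n) → v ≢ u → ¬ Any ((v , u) ∼_) as → ¬ Any ((v , u) ∼_) bs →
  Safe k ((v , u) ∷ as) → (∀ f → Survives k t ((v , u) ∷ as) (f ∷ bs)) →
  Survives k (suc t) as bs
survives-suc safe v u v≢u ∉as ∉bs safe' next A B A⊆ B⊆ (inj₁ lost) =
  safe⇒¬contains safe A⊆ lost
survives-suc safe v u v≢u ∉as ∉bs safe' next A B A⊆ B⊆ (inj₂ (_ , force))
  with edge v u v≢u
... | e , e∼ with force e ( unclaimed A e A⊆ (∉as ∘ Any-∼-resp e∼)
                           , unclaimed B e B⊆ (∉bs ∘ Any-∼-resp e∼))
...   | inj₁ lost = safe⇒¬contains safe' (covers-insert e A⊆ e∼) lost
...   | inj₂ (e' , _ , force') = next (proj₁ e') (insert e A) (insert e' B)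
          (covers-insert e A⊆ e∼) (covers-insert e' B⊆ ∼-refl) force'

-- (v , a , b) stands for the pair of edges va, vb: Avoider will claim one of them.
Fork : ℕ → Set
Fork n = Fin n × Pair n

Hits : Pair n → Fork n → Set
Hits p (v , a , b) = p ∼ (v , a) ⊎ p ∼ (v , b)

hits? : (p : Pair n) (x : Fork n) → Dec (Hits p x)
hits? p (v , a , b) = (p ∼? (v , a)) ⊎-dec (p ∼? (v , b))

Apart : Fork n → Fork n → Set
Apart x y = ∀ p → Hits p x → ¬ Hits p y

Proper : Fork n → Set
Proper (v , a , b) = ¬ (v , a) ∼ (v , b)

Below : (Fin n → ℕ) → Fork n → Set
Below ρ (v , a , b) = ρ a < ρ v × ρ b < ρ v

Unclaimed : List (Pair n) → List (Pair n) → Fork n → Set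
Unclaimed as bs x = ∀ p → Hits p x → ¬ Any (p ∼_) as × ¬ Any (p ∼_) bs

centres : List (Fork n) → List (Fin n)
centres = map proj₁

-- Both tips of a fork lie below its centre, so either edge keeps the claims descending. `capacity`
-- reserves one unit of out-degree for every fork still open, so playing all of them out never
-- exceeds `k`.
record Pairing (ρ : Fin n → ℕ) (k : ℕ) (as bs : List (Pair n)) (xs : List (Fork n)) : Set where
  field
    descending : Descending ρ as
    proper     : All Proper xs
    below      : All (Below ρ) xs
    free       : All (Unclaimed as bs) xs
    apart      : AllPairs Apart xs
    capacity   : ∀ v → count v (tops as) + count v (centres xs) ≤ k

  safe : Safe k as
  safe = descending⇒degenerate ρ descending (λ v → ≤-trans (m≤m+n _ _) (capacity v))

data Tip : Fork n → Fin n → Set where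
  left  : ∀ {v a b : Fin n} → Tip (v , a , b) a
  right : ∀ {v a b : Fin n} → Tip (v , a , b) b

tip-hits : {v u a b : Fin n} → Tip (v , a , b) u → Hits (v , u) (v , a , b)
tip-hits left  = inj₁ ∼-refl
tip-hits right = inj₂ ∼-refl

hits-resp : {p q : Pair n} (x : Fork n) → p ∼ q → Hits q x → Hits p x
hits-resp x p∼q = Sum.map (∼-trans p∼q) (∼-trans p∼q)

-- After Enforcer claims f, at most one fork has lost an edge; Avoider answers there.
answer : (f : Pair n) (x : Fork n) {xs : List (Fork n)} →
  All Proper (x ∷ xs) → AllPairs Apart (x ∷ xs) →
  ∃ λ y → ∃ λ u → ∃ λ ys →
    (x ∷ xs) ↭ (y ∷ ys) × Tip y u × ¬ f ∼ (proj₁ y , u) × All (¬_ ∘ Hits f) ys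
answer f x@(v , a , b) {xs} (prop ∷ props) (ap ∷ aps) with hits? f x
... | yes (inj₁ f∼va) = x , b , xs , ↭-refl , right
      , (λ f∼vb → prop (∼-trans (∼-sym f∼va) f∼vb))
      , All.map (λ apart → apart f (inj₁ f∼va)) ap
... | yes (inj₂ f∼vb) = x , a , xs , ↭-refl , left
      , (λ f∼va → prop (∼-trans (∼-sym f∼va) f∼vb))
      , All.map (λ apart → apart f (inj₂ f∼vb)) ap
answer f x {[]} (prop ∷ []) ([] ∷ []) | no ¬hit =
  x , _ , [] , ↭-refl , left , ¬hit ∘ inj₁ , []
answer f x {z ∷ xs} (prop ∷ props) (ap ∷ aps) | no ¬hit with answer f z props aps
... | y , u , ys , perm , tip , f≁ , misses =
  y , u , x ∷ ys , ↭-trans (↭-prep x perm) (↭-swap x y ↭-refl) , tip , f≁ , ¬hit ∷ misses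

-- `Pairing` describes the position before Enforcer's latest claim `f`, which may have damaged one
-- fork. Taking the intact edge there restores the invariant with `f` included, just in time for the
-- next claim.
pairing-survives : ∀ {ρ k} t f {as bs : List (Pair n)} {xs} → t ≤ length xs →
  Pairing ρ k as bs xs → Survives k t as (f ∷ bs)
pairing-survives zero f _ P = survives-zero (Pairing.safe P)
pairing-survives {ρ = ρ} {k} (suc t) f {as} {bs} {x ∷ xs} (s≤s t≤) P
  with answer f x (Pairing.proper P) (Pairing.apart P)
... | (v , a , b) , u , ys , perm , tip , f≁vu , misses =
  survives-suc safe v u v≢u (proj₁ vu-free)
    (λ { (here vu∼f) → f≁vu (∼-sym vu∼f) ; (there vu∈bs) → proj₂ vu-free vu∈bs })
    (Pairing.safe P') (λ f' → pairing-survives t f' t≤ys P')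
  where
  open Pairing P
  y = (v , a , b)

  t≤ys : t ≤ length ys
  t≤ys = ≤-trans t≤ (≤-reflexive (suc-injective (↭-length perm)))

  vu-free = All.head (All-resp-↭ perm free) (v , u) (tip-hits tip)

  tip-below : ∀ {a b} → Below ρ (v , a , b) → Tip (v , a , b) u → ρ u < ρ v
  tip-below (a< , b<) left  = a<
  tip-below (a< , b<) right = b<

  u<v : ρ u < ρ v
  u<v = tip-below (All.head (All-resp-↭ perm below)) tip

  v≢u : v ≢ u
  v≢u v≡u = <-irrefl (cong ρ (sym v≡u)) u<v

  y-apart : All (Apart y) ys × AllPairs Apart ys
  y-apart with Permutation.AllPairs-resp-↭ (setoid _)
      (λ ap p hy hx → ap p hx hy) (resp₂ Apart) (↭⇒↭ₛ perm) apart
  ... | ap ∷ aps = ap , aps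

  still-free : ∀ {z} → z ∈ ys → Unclaimed ((v , u) ∷ as) (f ∷ bs) z
  still-free {z} z∈ p p-hits =
    let ∉as , ∉bs = All.lookup (All.tail (All-resp-↭ perm free)) z∈ p p-hits
    in (λ where
          (here p∼vu)  → All.lookup (proj₁ y-apart) z∈ p (hits-resp y p∼vu (tip-hits tip)) p-hits
          (there p∈as) → ∉as p∈as)
     , (λ where
          (here p∼f)   → All.lookup misses z∈ (hits-resp z (∼-sym p∼f) p-hits)
          (there p∈bs) → ∉bs p∈bs)

  P' : Pairing ρ k ((v , u) ∷ as) (f ∷ bs) ys
  P' = record
    { descending = u<v ∷ descending
    ; proper     = All.tail (All-resp-↭ perm proper)
    ; below      = All.tail (All-resp-↭ perm below)
    ; free       = All.tabulate still-free
    ; apart      = proj₂ y-apart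
    -- One unit at `v` passes from the open forks to the claims, so the sum is unchanged.
    ; capacity   = λ w → begin
        δ w v + count w (tops as) + count w (centres ys)
          ≡⟨ rearrange (δ w v) (count w (tops as)) _ ⟩
        count w (tops as) + count w (centres (y ∷ ys))
          ≡⟨ cong (count w (tops as) +_) (sum-↭ (map⁺ (δ w) (map⁺ proj₁ perm))) ⟨
        count w (tops as) + count w (centres (x ∷ xs))
          ≤⟨ capacity w ⟩
        k ∎
    }
    where
    open ≤-Reasoning
    rearrange : ∀ a b c → a + b + c ≡ b + (a + c)
    rearrange = solve-∀

-- Building the hubs

-- A vertex outside xs gets position length xs, above all members.
position : List (Fin n) → Fin n → ℕ
position []       v = 0
position (x ∷ xs) v with x ≟ v
... | yes _ = 0
... | no _  = suc (position xs v)

position-∈ : {u : Fin n} (P Q : List (Fin n)) → u ∈ P → position (P ++ Q) u ≡ position P u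
position-∈ {u = u} (x ∷ P) Q u∈ with x ≟ u | u∈
... | yes _   | _         = refl
... | no x≢u | here u≡x   = contradiction (sym u≡x) x≢u
... | no _    | there u∈P = cong suc (position-∈ P Q u∈P)

position-mono : (v : Fin n) (P Q : List (Fin n)) → position P v ≤ position (P ++ Q) v
position-mono v []      Q = z≤n
position-mono v (x ∷ P) Q with x ≟ v
... | yes _ = z≤n
... | no _  = s≤s (position-mono v P Q)

position-< : {u v : Fin n} (P : List (Fin n)) → u ∈ P → v ∉ P → position P u < position P v
position-< {u = u} {v} (x ∷ P) u∈ v∉ with x ≟ u | x ≟ v | u∈
... | _       | yes x≡v | _         = contradiction (here (sym x≡v)) v∉
... | yes _   | no _    | _         = s≤s z≤n
... | no x≢u  | no _    | here u≡x  = contradiction (sym u≡x) x≢u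
... | no _    | no _    | there u∈P = s≤s (position-< P u∈P (v∉ ∘ there))

-- Appending fixes the position of a member and can only raise that of an outsider. So claims stay
-- descending when hubs are added, and again when the other layers are.
position-<-++ : {u v : Fin n} (P Q : List (Fin n)) → u ∈ P → position P u < position P v →
  position (P ++ Q) u < position (P ++ Q) v
position-<-++ {v = v} P Q u∈ lt =
  ≤-trans (≤-<-trans (≤-reflexive (position-∈ P Q u∈)) lt) (position-mono v P Q)

-- hs lists the hubs in the order in which they were chosen.
record HubGraph (hs : List (Fin n)) (as bs : List (Pair n)) : Set where
  field
    order    : All (λ p → proj₂ p ∈ hs × position hs (proj₂ p) < position hs (proj₁ p)) as
    outdeg   : ∀ v → count v (tops as) ≤ length hs
    hubs!    : Unique hs
    clique   : length hs C 2 ≤ sumOver hs (λ h → count h (tops as))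
    balanced : length bs ≤ length as

  safe : ∀ {k} → length hs ≤ k → Safe k as
  safe hs≤k = descending⇒degenerate (position hs) (All.map proj₂ order)
    (λ v → ≤-trans (outdeg v) hs≤k)

-- Being joined to all hubs is recorded as a number of claims, the form in which the out-degree and
-- edge counts consume it.
record Candidates (hs : List (Fin n)) (as : List (Pair n)) (cs : List (Fin n)) : Set where
  field
    cands!  : Unique cs
    cand∉   : ∀ c → c ∈ cs → c ∉ hs
    joined  : ∀ c → c ∈ cs → count c (tops as) ≡ length hs

-- Used while the star at the newest hub `h` is being built. There `hs` already contains `h`, so `i`
-- is one less than `length hs`.
record Pool (hs : List (Fin n)) (h : Fin n) (i : ℕ) (as bs : List (Pair n))
            (ps : List (Fin n)) : Set where
  field
    pool!   : Unique ps
    pool∉   : ∀ p → p ∈ ps → p ∉ hs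
    waiting : ∀ p → p ∈ ps → count p (tops as) ≡ i
    open-as : ∀ p → p ∈ ps → ¬ Any ((p , h) ∼_) as
    open-bs : ∀ p → p ∈ ps → ¬ Any ((p , h) ∼_) bs

-- The one pool vertex that a claim `f` of Enforcer can separate from `h`. If `f` misses `h` the
-- value is arbitrary, and deleting it from the pool does no harm.
otherEnd : Fin n → Pair n → Fin n
otherEnd h (x , y) with x ≟ h
... | yes _ = y
... | no _  = x

otherEnd-unique : {h q : Fin n} (f : Pair n) → q ≢ h → (q , h) ∼ f → q ≡ otherEnd h f
otherEnd-unique {h = h} (x , y) q≢h q,h∼f with x ≟ h | q,h∼f
... | yes refl | inj₁ (q≡x , _)   = contradiction q≡x q≢h
... | yes refl | inj₂ (q≡y , _)   = q≡y
... | no _     | inj₁ (q≡x , _)   = q≡x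
... | no x≢h  | inj₂ (_ , h≡x)   = contradiction (sym h≡x) x≢h

-- What the phase after a star must provide. Enforcer's claims are left open, but the numbers of
-- candidates and of Avoider's moves are exact, since a completed star has a prescribed size.
Continuation : ℕ → ℕ → List (Fin n) → ℕ → ℕ → Set
Continuation {n} k E hs size moves = ∀ {as bs : List (Pair n)} {cs} t →
  HubGraph hs as bs → Candidates hs as cs → length cs ≡ size → length as ≡ moves →
  t + length as ≤ E → Survives k t as bs

-- Each round costs the pool at most two vertices: the one Avoider joins to h and
-- the one Enforcer separates from h.
star-survives : ∀ {k E i} {hs : List (Fin n)} {h} → length hs ≤ k → length hs ≡ suc i → h ∈ hs →
  ∀ m t {as bs ps ds} → 2 * m ≤ length ps →
  HubGraph hs as bs → Pool hs h i as bs ps → Candidates hs as ds →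
  t + length as ≤ E → Continuation k E hs (m + length ds) (m + length as) →
  Survives k t as bs
star-survives _ _ _ zero t _ G _ D t≤ next = next t G D refl refl t≤
star-survives hs≤k _ _ (suc m) zero _ G _ _ _ _ = survives-zero (HubGraph.safe G hs≤k)
star-survives {k = k} {E} {i} {hs} {h} hs≤k |hs| h∈ (suc m) (suc t) {as} {bs} {p ∷ ps} {ds}
  2m≤ G P D t≤ next =
  survives-suc (HubGraph.safe G hs≤k) p h p≢h (open-as p (here refl)) (open-bs p (here refl))
    (HubGraph.safe (G' {bs} (≤-trans balanced (n≤1+n _))) hs≤k)
    λ f → star-survives hs≤k |hs| h∈ m t (2m≤' f) (G' (s≤s balanced)) (P' f) D'
      (≤-trans (≤-reflexive (+-suc t (length as))) t≤)
      λ t' G″ D″ |cs| |as| → next t' G″ D″ (trans |cs| (+-suc m _)) (trans |as| (+-suc m _))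
  where
  open HubGraph G
  open Pool P
  open Candidates D

  as' = (p , h) ∷ as

  p≢h : p ≢ h
  p≢h p≡h = pool∉ p (here refl) (subst (_∈ hs) (sym p≡h) h∈)

  G' : ∀ {bs'} → length bs' ≤ length as' → HubGraph hs as' bs'
  G' bal = record
    { order    = (h∈ , position-< hs h∈ (pool∉ p (here refl))) ∷ order
    ; outdeg   = outdeg'
    ; hubs!    = hubs!
    ; clique   = ≤-trans clique (sumOver-mono hs (λ w _ → m≤n+m _ (δ w p)))
    ; balanced = bal
    }
    where
    outdeg' : ∀ v → δ v p + count v (tops as) ≤ length hs
    outdeg' v with v ≟ p
    ... | yes refl = ≤-reflexive (trans (cong suc (waiting p (here refl))) (sym |hs|))
    ... | no _     = outdeg v

  ps∖ : Pair _ → List (Fin _)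
  ps∖ f = ps ∖ (otherEnd h f ∷ [])

  ps! : Unique ps
  ps! with pool!
  ... | _ ∷ u = u

  p≢ : ∀ {q} → q ∈ ps → q ≢ p
  p≢ q∈ q≡p with pool!
  ... | p∉ ∷ _ = All.lookup p∉ q∈ (sym q≡p)

  2m≤' : ∀ f → 2 * m ≤ length (ps∖ f)
  2m≤' f = +-cancelˡ-≤ 2 _ _ (begin
    2 + 2 * m                ≡⟨ *-suc 2 m ⟨
    2 * suc m                ≤⟨ 2m≤ ⟩
    suc (length ps)          ≤⟨ s≤s (length-∖ (otherEnd h f ∷ []) ps!) ⟩
    2 + length (ps∖ f)       ∎)
    where open ≤-Reasoning

  P' : ∀ f → Pool hs h i as' (f ∷ bs) (ps∖ f)
  P' f = record
    { pool!   = ∖-unique (otherEnd h f ∷ []) ps!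
    ; pool∉   = λ q q∈ → pool∉ q (there (in-ps q∈))
    ; waiting = λ q q∈ → trans (cong (_+ _) (δ-≢ (p≢ (in-ps q∈)))) (waiting q (there (in-ps q∈)))
    ; open-as = λ where
        q q∈ (here (inj₁ (q≡p , _))) → p≢ (in-ps q∈) q≡p
        q q∈ (here (inj₂ (q≡h , _))) → q≢h q∈ q≡h
        q q∈ (there found)           → open-as q (there (in-ps q∈)) found
    ; open-bs = λ where
        q q∈ (here q,h∼f)  → proj₂ (∈-∖⁻ ps _ q∈) (here (otherEnd-unique f (q≢h q∈) q,h∼f))
        q q∈ (there found) → open-bs q (there (in-ps q∈)) found
    }
    where
    in-ps : ∀ {q} → q ∈ ps∖ f → q ∈ ps
    in-ps q∈ = proj₁ (∈-∖⁻ ps _ q∈)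
    q≢h : ∀ {q} → q ∈ ps∖ f → q ≢ h
    q≢h q∈ q≡h = pool∉ _ (there (in-ps q∈)) (subst (_∈ hs) (sym q≡h) h∈)

  -- A finished candidate has one claim more than a vertex still in the pool.
  p≢d : ∀ {d} → d ∈ ds → p ≢ d
  p≢d d∈ refl = 1+n≢n (trans (sym |hs|) (trans (sym (joined _ d∈)) (waiting p (here refl))))

  D' : Candidates hs as' (p ∷ ds)
  D' = record
    { cands! = All.tabulate p≢d ∷ cands!
    ; cand∉  = λ where
        c (here refl) → pool∉ p (here refl)
        c (there c∈)  → cand∉ c c∈
    ; joined = λ where
        c (here refl) → trans (cong₂ _+_ (δ-refl p) (waiting p (here refl))) (sym |hs|)
        c (there c∈)  → trans (cong (_+ _) (δ-≢ (p≢d c∈ ∘ sym))) (joined c c∈)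
    }

-- The new hub was a candidate, so it brings `length hs` claims towards the earlier hubs, exactly
-- the growth of the binomial in `clique`.
add-hub : {hs : List (Fin n)} {h : Fin n} {as bs : List (Pair n)} → h ∉ hs →
  count h (tops as) ≡ length hs → HubGraph hs as bs → HubGraph (hs ++ h ∷ []) as bs
add-hub {hs = hs} {h} {as} h∉ joined G = record
  { order    = All.map (λ (u∈ , lt) → ∈-++⁺ˡ u∈ , position-<-++ hs (h ∷ []) u∈ lt) order
  ; outdeg   = λ v → ≤-trans (outdeg v) (≤-trans (n≤1+n _) (≤-reflexive (sym |hs'|)))
  ; hubs!    = Unique.++⁺ hubs! ([] ∷ []) λ { (h∈ , here refl) → h∉ h∈ }
  ; clique   = begin
      length (hs ++ h ∷ []) C 2                    ≡⟨ cong (_C 2) |hs'| ⟩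
      suc (length hs) C 2                          ≡⟨ suc-C2 (length hs) ⟩
      length hs C 2 + length hs                    ≤⟨ +-mono-≤ clique (≤-reflexive
                                                        (trans (sym joined) (sym (+-identityʳ _)))) ⟩
      sumOver hs outdegree + sumOver (h ∷ []) outdegree
                                                   ≡⟨ sumOver-++ hs (h ∷ []) outdegree ⟨
      sumOver (hs ++ h ∷ []) outdegree             ∎
  ; balanced = balanced
  }
  where
  open HubGraph G
  open ≤-Reasoning
  outdegree = λ v → count v (tops as)
  |hs'| : length (hs ++ h ∷ []) ≡ suc (length hs)
  |hs'| = trans (length-++ hs) (+-comm _ 1)

-- Completing the graph by pairing

zip-∈ : {a b : A} (P Q : List A) → (a , b) ∈ zip P Q → a ∈ P × b ∈ Q
zip-∈ (_ ∷ P) (_ ∷ Q) (here refl) = here refl , here refl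
zip-∈ (_ ∷ P) (_ ∷ Q) (there ab∈) = let a∈ , b∈ = zip-∈ P Q ab∈ in there a∈ , there b∈

infix 4 _isTipOf_
_isTipOf_ : Fin n → Pair n → Set
w isTipOf (a , b) = w ≡ a ⊎ w ≡ b

Separate : Pair n → Pair n → Set
Separate x y = ∀ w → w isTipOf x → ¬ w isTipOf y

zip-separate : {P Q : List (Fin n)} → Unique P → Unique Q → (∀ {v} → v ∈ P → v ∉ Q) →
  AllPairs Separate (zip P Q)
zip-separate []        _         _    = []
zip-separate (_ ∷ _)   []        _    = []
zip-separate {P = a ∷ P} {b ∷ Q} (a∉ ∷ P!) (b∉ ∷ Q!) disj =
  All.tabulate separate ∷ zip-separate P! Q! (λ v∈P v∈Q → disj (there v∈P) (there v∈Q))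
  where
  separate : ∀ {cd} → cd ∈ zip P Q → Separate (a , b) cd
  separate {c , d} cd∈ w w∈ab w∈cd with zip-∈ P Q cd∈
  ... | c∈P , d∈Q with w∈ab | w∈cd
  ...   | inj₁ refl | inj₁ refl = All.lookup a∉ c∈P refl
  ...   | inj₁ refl | inj₂ refl = disj (here refl) (there d∈Q)
  ...   | inj₂ refl | inj₁ refl = disj (there c∈P) (here refl)
  ...   | inj₂ refl | inj₂ refl = All.lookup b∉ d∈Q refl

∼-cancel : {v u w : Fin n} → (v , u) ∼ (v , w) → u ≡ w
∼-cancel (inj₁ (_ , u≡w))   = u≡w
∼-cancel (inj₂ (v≡w , u≡v)) = trans u≡v v≡w

hits⇒tip : {p : Pair n} {v a b : Fin n} → Hits p (v , a , b) →
  ∃ λ w → w isTipOf (a , b) × p ∼ (v , w)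
hits⇒tip (inj₁ p∼) = _ , inj₁ refl , p∼
hits⇒tip (inj₂ p∼) = _ , inj₂ refl , p∼

below-tip : {ρ : Fin n → ℕ} {v a b w : Fin n} → Below ρ (v , a , b) → w isTipOf (a , b) →
  ρ w < ρ v
below-tip (a< , _) (inj₁ refl) = a<
below-tip (_ , b<) (inj₂ refl) = b<

apart-same : {v : Fin n} {x y : Pair n} → Separate x y → Apart (v , x) (v , y)
apart-same sep p p-hits-x p-hits-y with hits⇒tip p-hits-x | hits⇒tip p-hits-y
... | w , w∈ , p∼vw | w' , w'∈ , p∼vw' with ∼-cancel (∼-trans (∼-sym p∼vw) p∼vw')
...   | refl = sep w w∈ w'∈

-- Forks with different centres can share an edge only if each centre is a tip of the other fork;
-- then each centre would lie strictly below the other.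
apart-distinct : (ρ : Fin n → ℕ) {v v' : Fin n} {x y : Pair n} → v ≢ v' →
  Below ρ (v , x) → Below ρ (v' , y) → Apart (v , x) (v' , y)
apart-distinct ρ v≢v' below-x below-y p p-hits-x p-hits-y
  with hits⇒tip p-hits-x | hits⇒tip p-hits-y
... | w , w∈ , p∼vw | w' , w'∈ , p∼v'w' with ∼-trans (∼-sym p∼vw) p∼v'w'
...   | inj₁ (v≡v' , _)    = v≢v' v≡v'
...   | inj₂ (refl , refl) = <-asym (below-tip {ρ = ρ} below-x w∈) (below-tip {ρ = ρ} below-y w'∈)

count-tagged : (v w : Fin n) (ps : List A) →
  sumOver (map (w ,_) ps) (λ x → δ v (proj₁ x)) ≡ length ps * δ v w
count-tagged v w []       = refl
count-tagged v w (p ∷ ps) = cong (δ v w +_) (count-tagged v w ps)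

Σδ-select : (v : Fin n) {L : List (Fin n)} → Unique L → (f : Fin n → ℕ) →
  sumOver L (λ w → f w * δ v w) ≤ f v
Σδ-select v [] f = z≤n
Σδ-select v {w ∷ L} (w∉ ∷ L!) f with v ≟ w
... | yes refl = ≤-reflexive (trans (cong₂ _+_ (*-identityʳ (f v)) (vanish w∉)) (+-identityʳ (f v)))
  where
  vanish : ∀ {L} → All (v ≢_) L → sumOver L (λ w → f w * δ v w) ≡ 0
  vanish []              = refl
  vanish {x ∷ _} (v≢ ∷ r) =
    cong₂ _+_ (trans (cong (f x *_) (δ-≢ v≢)) (*-zeroʳ (f x))) (vanish r)
... | no _     = +-mono-≤ (≤-reflexive (*-zeroʳ (f w))) (Σδ-select v L! f)

sumOver-concatMap : {B : Set} (g : A → List B) (f : B → ℕ) (L : List A) →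
  sumOver (concatMap g L) f ≡ sumOver L (λ x → sumOver (g x) f)
sumOver-concatMap g f []      = refl
sumOver-concatMap g f (x ∷ L) =
  trans (sumOver-++ (g x) (concatMap g L) f) (cong (_ +_) (sumOver-concatMap g f L))

length-concatMap : {B : Set} (g : A → List B) (L : List A) →
  length (concatMap g L) ≡ sumOver L (length ∘ g)
length-concatMap g []      = refl
length-concatMap g (x ∷ L) = trans (length-++ (g x)) (cong (_ +_) (length-concatMap g L))

fork-list : (Fin n → List (Pair n)) → Fin n → List (Fork n)
fork-list slots v = map (v ,_) (slots v)

count-centres : (slots : Fin n → List (Pair n)) {L : List (Fin n)} → Unique L → (v : Fin n) →
  count v (centres (concatMap (fork-list slots) L)) ≤ length (slots v)
count-centres slots {L} L! v = begin
  sumOver (centres (concatMap (fork-list slots) L)) (δ v)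
    ≡⟨ cong sum (map-∘ (concatMap (fork-list slots) L)) ⟨
  sumOver (concatMap (fork-list slots) L) (δ v ∘ proj₁)
    ≡⟨ sumOver-concatMap (fork-list slots) (δ v ∘ proj₁) L ⟩
  sumOver L (λ w → sumOver (fork-list slots w) (δ v ∘ proj₁))
    ≤⟨ sumOver-mono L (λ w _ → ≤-reflexive (count-tagged v w (slots w))) ⟩
  sumOver L (λ w → length (slots w) * δ v w)
    ≤⟨ Σδ-select v L! (length ∘ slots) ⟩
  length (slots v) ∎
  where open ≤-Reasoning

apart-concat : (ρ : Fin n → ℕ) (slots : Fin n → List (Pair n)) {L : List (Fin n)} → Unique L →
  (∀ v → AllPairs Separate (slots v)) → (∀ v x → x ∈ slots v → Below ρ (v , x)) →
  AllPairs Apart (concatMap (fork-list slots) L)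
apart-concat ρ slots {L} L! separate below = AllPairs.concat⁺
  (All.map⁺ (All.tabulate {xs = L}
    (λ {v} _ → AllPairs.map⁺ (AllPairs.map apart-same (separate v)))))
  (AllPairs.map⁺ (AllPairs.map
    (λ {v} {w} v≢w → All.map⁺ (All.tabulate λ x∈ → All.map⁺ (All.tabulate λ y∈ →
      apart-distinct ρ v≢w (below v _ x∈) (below w _ y∈))))
    L!))

-- The reserve ys, zs supplies the 2k free back-neighbours of every vertex that
-- Enforcer may already have separated from the hubs.
record Reserve (hs cs : List (Fin n)) (as bs : List (Pair n)) (ys zs : List (Fin n)) : Set where
  field
    ys!       : Unique ys
    zs!       : Unique zs
    ys∩zs     : ∀ {v} → v ∈ ys → v ∉ zs
    untouched : ∀ {v} → v ∈ ys ++ zs →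
                v ∉ hs ++ cs × v ∉ ends as × v ∉ ends bs

module Completion {n k : ℕ} {hs cs ys zs : List (Fin n)} {as bs : List (Pair n)}
  (|hs| : length hs ≡ k) (|cs| : length cs ≡ k) (|ys| : length ys ≡ k) (|zs| : length zs ≡ k)
  (G : HubGraph hs as bs) (D : Candidates hs as cs) (R : Reserve hs cs as bs ys zs) where

  open HubGraph G hiding (safe)
  open Candidates D
  open Reserve R

  -- Four layers: hubs, candidates, reserve, and all remaining vertices tied at the top. Forks at
  -- the reserve point to the first two layers, forks at the remaining vertices to the reserve.
  ρ : Fin n → ℕ
  ρ = position ((hs ++ cs) ++ (ys ++ zs))

  outdegree : Fin n → ℕ
  outdegree v = count v (tops as)

  -- Candidates fall into the last case although the reserve lies above them. They already have `k`
  -- claims, so `chosen` keeps none of these slots; `hungry` records this.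
  slots : Fin n → List (Pair n)
  slots v with v ∈? hs | v ∈? (ys ++ zs)
  ... | yes _ | _     = []
  ... | no _  | yes _ = zip hs cs
  ... | no _  | no _  = zip ys zs

  -- A vertex that dropped out of the candidates midway keeps its claims to hubs and receives forks
  -- only for the missing ones.
  chosen : Fin n → List (Pair n)
  chosen v = take (k ∸ outdegree v) (slots v)

  others : List (Fin n)
  others = allFin n ∖ hs

  forks : List (Fork n)
  forks = concatMap (fork-list chosen) others

  length-chosen-≤ : ∀ v → length (chosen v) ≤ k ∸ outdegree v
  length-chosen-≤ v = ≤-trans (≤-reflexive (length-take _ (slots v))) (m⊓n≤m _ _)

  length-zip : (P Q : List (Fin n)) → length P ≡ k → length Q ≡ k → length (zip P Q) ≡ k
  length-zip P Q |P| |Q| = trans (length-zipWith _,_ P Q)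
    (trans (cong₂ _⊓_ |P| |Q|) (⊓-idem k))

  length-slots : ∀ v → v ∉ hs → length (slots v) ≡ k
  length-slots v v∉ with v ∈? hs | v ∈? (ys ++ zs)
  ... | yes v∈ | _     = contradiction v∈ v∉
  ... | no _   | yes _ = length-zip hs cs |hs| |cs|
  ... | no _   | no _  = length-zip ys zs |ys| |zs|

  length-chosen : ∀ v → v ∉ hs → length (chosen v) ≡ k ∸ outdegree v
  length-chosen v v∉ = length-take-≤ (slots v)
    (≤-trans (m∸n≤m k (outdegree v)) (≤-reflexive (sym (length-slots v v∉))))

  cs∉hs : ∀ {v} → v ∈ hs → v ∉ cs
  cs∉hs v∈hs v∈cs = cand∉ _ v∈cs v∈hs

  slots-separate : ∀ v → AllPairs Separate (slots v)
  slots-separate v with v ∈? hs | v ∈? (ys ++ zs)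
  ... | yes _ | _     = []
  ... | no _  | yes _ = zip-separate hubs! cands! cs∉hs
  ... | no _  | no _  = zip-separate ys! zs! ys∩zs

  data Slot (v : Fin n) : Pair n → Set where
    toHubs    : ∀ {a b} → v ∈ ys ++ zs → a ∈ hs → b ∈ cs → Slot v (a , b)
    toReserve : ∀ {a b} → v ∉ hs → v ∉ ys ++ zs → a ∈ ys → b ∈ zs → Slot v (a , b)

  slot : ∀ v {x} → x ∈ slots v → Slot v x
  slot v x∈ with v ∈? hs | v ∈? (ys ++ zs)
  ... | no _  | yes v∈ = let a∈ , b∈ = zip-∈ hs cs x∈ in toHubs v∈ a∈ b∈
  ... | no v∉ | no v∉' = let a∈ , b∈ = zip-∈ ys zs x∈ in toReserve v∉ v∉' a∈ b∈

  hungry : ∀ v {x} → x ∈ chosen v → v ∉ cs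
  hungry v x∈ v∈cs = empty x∈ (≤-trans (length-chosen-≤ v) (≤-reflexive (begin
    k ∸ outdegree v    ≡⟨ cong (k ∸_) (trans (joined v v∈cs) |hs|) ⟩
    k ∸ k              ≡⟨ n∸n≡0 k ⟩
    0                  ∎)))
    where
    open ≡-Reasoning
    empty : ∀ {x : Pair n} {xs} → x ∈ xs → ¬ length xs ≤ 0
    empty (here _)  ()
    empty (there _) ()

  chosen-slot : ∀ v {x} → x ∈ chosen v → Slot v x
  chosen-slot v x∈ = slot v (∈-take (k ∸ outdegree v) x∈)

  ρ-reserve : ∀ {u v} → u ∈ hs ++ cs → v ∉ hs ++ cs → ρ u < ρ v
  ρ-reserve u∈ v∉ = position-<-++ (hs ++ cs) (ys ++ zs) u∈ (position-< (hs ++ cs) u∈ v∉)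

  ρ-last : ∀ {u v} → u ∈ ys ++ zs → v ∉ hs → v ∉ cs → v ∉ ys ++ zs → ρ u < ρ v
  ρ-last u∈ v∉hs v∉cs v∉ = position-< ((hs ++ cs) ++ (ys ++ zs)) (∈-++⁺ʳ (hs ++ cs) u∈)
    ([ [ v∉hs , v∉cs ]′ ∘ ∈-++⁻ hs , v∉ ]′ ∘ ∈-++⁻ (hs ++ cs))

  chosen-below : ∀ v x → x ∈ chosen v → Below ρ (v , x)
  chosen-below v x x∈ with chosen-slot v x∈
  ... | toHubs v∈ a∈ b∈ = let v∉ , _ = untouched v∈ in
    ρ-reserve (∈-++⁺ˡ a∈) v∉ , ρ-reserve (∈-++⁺ʳ hs b∈) v∉
  ... | toReserve v∉hs v∉ a∈ b∈ =
      ρ-last (∈-++⁺ˡ a∈) v∉hs (hungry v x∈) v∉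
    , ρ-last (∈-++⁺ʳ ys b∈) v∉hs (hungry v x∈) v∉

  chosen-proper : ∀ v x → x ∈ chosen v → Proper (v , x)
  chosen-proper v x x∈ va∼vb with ∼-cancel va∼vb | chosen-slot v x∈
  ... | refl | toHubs _ a∈ a∈'      = cs∉hs a∈ a∈'
  ... | refl | toReserve _ _ a∈ a∈' = ys∩zs a∈ a∈'

  slot-untouched : ∀ {v x w} → Slot v x → w isTipOf x → v ∈ ys ++ zs ⊎ w ∈ ys ++ zs
  slot-untouched (toHubs v∈ _ _)        _           = inj₁ v∈
  slot-untouched (toReserve _ _ a∈ b∈) (inj₁ refl) = inj₂ (∈-++⁺ˡ a∈)
  slot-untouched (toReserve _ _ a∈ b∈) (inj₂ refl) = inj₂ (∈-++⁺ʳ ys b∈)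

  -- Each edge of a fork has an end in the reserve, as centre or as tip, and no earlier claim of
  -- either player meets the reserve.
  chosen-free : ∀ v x → x ∈ chosen v → Unclaimed as bs (v , x)
  chosen-free v x x∈ p p-hits with hits⇒tip p-hits
  ... | w , w∈ , p∼vw with slot-untouched (chosen-slot v x∈) w∈
  ...   | inj₁ v∈ = let _ , ∉as , ∉bs = untouched v∈ in
      ∉as ∘ proj₁ ∘ ∈-ends ∘ Any-∼-resp p∼vw , ∉bs ∘ proj₁ ∘ ∈-ends ∘ Any-∼-resp p∼vw
  ...   | inj₂ w∈Y = let _ , ∉as , ∉bs = untouched w∈Y in
      ∉as ∘ proj₂ ∘ ∈-ends ∘ Any-∼-resp p∼vw , ∉bs ∘ proj₂ ∘ ∈-ends ∘ Any-∼-resp p∼vw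

  all-forks : {P : Fork n → Set} → (∀ v x → x ∈ chosen v → P (v , x)) → All P forks
  all-forks holds = All.concat⁺ (All.map⁺ (All.tabulate {xs = others}
    λ {v} _ → All.map⁺ (All.tabulate λ x∈ → holds v _ x∈)))

  others! : Unique others
  others! = ∖-unique hs (Unique.allFin⁺ n)

  pairing : Pairing ρ k as bs forks
  pairing = record
    { descending = All.map (λ (u∈ , lt) →
        position-<-++ (hs ++ cs) (ys ++ zs) (∈-++⁺ˡ u∈) (position-<-++ hs cs u∈ lt)) order
    ; proper     = all-forks chosen-proper
    ; below      = all-forks chosen-below
    ; free       = all-forks chosen-free
    ; apart      = apart-concat ρ chosen others!
                     (λ v → AllPairs.take⁺ (k ∸ outdegree v) (slots-separate v)) chosen-below
    ; capacity   = λ v → begin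
        outdegree v + count v (centres forks)
          ≤⟨ +-monoʳ-≤ _ (≤-trans (count-centres chosen others! v) (length-chosen-≤ v)) ⟩
        outdegree v + (k ∸ outdegree v)
          ≡⟨ m+[n∸m]≡n (≤-trans (outdeg v) (≤-reflexive |hs|)) ⟩
        k ∎
    }
    where open ≤-Reasoning

  -- Forks fill every vertex outside `hs` up to out-degree `k`, the hubs account for `k C 2` claims
  -- by `clique`, and the out-degrees already present sum to at most `length as`.
  enough-forks : eBound n k ≤ length forks + length as
  enough-forks = begin
    (n ∸ k) * k + k C 2
      ≤⟨ +-monoˡ-≤ _ (*-monoˡ-≤ k (m≤n+o⇒m∸n≤o n k n≤)) ⟩
    length others * k + k C 2
      ≡⟨ cong (_+ k C 2) (sumOver-const others k) ⟨
    sumOver others (λ _ → k) + k C 2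
      ≤⟨ +-mono-≤ (sumOver-mono others fill)
                  (subst (λ m → m C 2 ≤ sumOver hs outdegree) |hs| clique) ⟩
    sumOver others (λ v → length (chosen v) + outdegree v) + sumOver hs outdegree
      ≡⟨ cong (_+ sumOver hs outdegree) (sumOver-+ others (length ∘ chosen) outdegree) ⟩
    sumOver others (length ∘ chosen) + sumOver others outdegree + sumOver hs outdegree
      ≡⟨ +-assoc (sumOver others (length ∘ chosen)) (sumOver others outdegree) (sumOver hs outdegree) ⟩
    sumOver others (length ∘ chosen) + (sumOver others outdegree + sumOver hs outdegree)
      ≤⟨ +-mono-≤ (≤-reflexive (sym |forks|)) outdegrees≤ ⟩
    length forks + length as ∎
    where
    open ≤-Reasoning
    n≤ : n ≤ k + length others
    n≤ = subst₂ (λ l m → l ≤ m + length others) (length-allFin n) |hs|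
           (length-∖ hs (Unique.allFin⁺ n))

    fill : ∀ v → v ∈ others → k ≤ length (chosen v) + outdegree v
    fill v v∈ = begin
      k                                 ≤⟨ m≤n+m∸n k (outdegree v) ⟩
      outdegree v + (k ∸ outdegree v)   ≡⟨ +-comm (outdegree v) _ ⟩
      k ∸ outdegree v + outdegree v     ≡⟨ cong (_+ outdegree v)
                                             (length-chosen v (proj₂ (∈-∖⁻ (allFin n) hs v∈))) ⟨
      length (chosen v) + outdegree v   ∎

    |forks| : length forks ≡ sumOver others (length ∘ chosen)
    |forks| = trans (length-concatMap (fork-list chosen) others)
      (cong sum (map-cong (λ v → length-map (v ,_) (chosen v)) others))

    outdegrees≤ : sumOver others outdegree + sumOver hs outdegree ≤ length as
    outdegrees≤ = begin
      sumOver others outdegree + sumOver hs outdegree  ≡⟨ sumOver-++ others hs outdegree ⟨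
      sumOver (others ++ hs) outdegree                 ≤⟨ Σcount≤length (Unique.++⁺ others! hubs!
                                                            λ (v∈ , v∈hs) → proj₂ (∈-∖⁻ (allFin n) hs v∈) v∈hs)
                                                            (tops as) ⟩
      length (tops as)                                 ≡⟨ length-map proj₁ as ⟩
      length as                                        ∎

-- Sizes of the candidate sets and composition of the phases

-- The number of candidates kept while j hubs are still to be chosen. It shrinks by a
-- factor 4 per hub: half is lost in the star, and at most a quarter to edges that
-- Enforcer claimed at the new hub beforehand.
size : ℕ → ℕ → ℕ
size k j = 2 * 4 ^ k * 4 ^ j

1≤size : ∀ k j → 1 ≤ size k j
1≤size k j = *-mono-≤ {1} {2 * 4 ^ k} {1} {4 ^ j}
  (*-mono-≤ {1} {2} {1} {4 ^ k} (s≤s z≤n) (m^n>0 4 k)) (m^n>0 4 j)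

size-suc : ∀ k j → size k (suc j) ≡ 4 * size k j
size-suc k j = swap (2 * 4 ^ k) (4 ^ j)
  where
  swap : ∀ a b → a * (4 * b) ≡ 4 * (a * b)
  swap = solve-∀

size-0≤ : ∀ k j → size k 0 ≤ size k j
size-0≤ k j = *-monoʳ-≤ (2 * 4 ^ k) (m^n>0 4 j)

-- The reason for the factor `2 * 4 ^ k` in `size`. Enforcer's claims in the hub phase have at most
-- `size k k + size k k` ends, while the number of candidates and the tolerated number of claims at
-- a hub are each at least `size k 0`; so averaging finds a hub.
size-square : ∀ k → size k k + size k k ≡ size k 0 * size k 0
size-square k = square (4 ^ k)
  where
  square : ∀ x → 2 * x * x + 2 * x * x ≡ 2 * x * 1 * (2 * x * 1)
  square = solve-∀

n≤4^n : ∀ n → n ≤ 4 ^ n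
n≤4^n zero    = z≤n
n≤4^n (suc n) = begin
  1 + n            ≤⟨ +-mono-≤ (m^n>0 4 n) (n≤4^n n) ⟩
  4 ^ n + 4 ^ n    ≤⟨ +-monoʳ-≤ (4 ^ n) (m≤m+n (4 ^ n) _) ⟩
  4 * 4 ^ n        ∎
  where open ≤-Reasoning

finish-survives : ∀ {k} t {hs as bs cs} → 1 ≤ k → length hs ≡ k → k ≤ length cs →
  HubGraph hs as bs → Candidates {n} hs as cs →
  4 * k + 4 * length as ≤ n → t + length as ≤ eBound n k → Survives k t as bs
finish-survives t {[]} () refl
finish-survives {n = n} {k} t {hs@(h ∷ _)} {as} {bs} {cands} _ |hs| k≤ G D large t≤ A B A⊆ B⊆ =
  -- Avoider opens this phase with no claim to answer. The loop `(h , h)` stands in for one; it only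
  -- enlarges the list covering `B`.
  pairing-survives t (h , h) t≤forks F.pairing A B A⊆ (λ e Be → there (B⊆ e Be))
  where
  open HubGraph G hiding (safe)
  open Candidates D
  cs = take k cands

  D' : Candidates hs as cs
  D' = record
    { cands! = Unique.take⁺ k cands!
    ; cand∉  = λ c → cand∉ c ∘ ∈-take k
    ; joined = λ c → joined c ∘ ∈-take k
    }

  |cs| : length cs ≡ k
  |cs| = length-take-≤ cands k≤

  touched = (hs ++ cs) ++ (ends as ++ ends bs)

  -- Hubs, candidates, `ys` and `zs` take `k` vertices each. Every claim has two ends, and
  -- `balanced` bounds Enforcer's claims by Avoider's.
  room : k + length touched + k ≤ n
  room = begin
    k + length touched + k
      ≡⟨ cong (λ l → k + l + k) (trans (length-++ (hs ++ cs))
           (cong₂ _+_ (trans (length-++ hs) (cong₂ _+_ |hs| |cs|))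
                      (trans (length-++ (ends as)) (cong₂ _+_ (length-ends as) (length-ends bs))))) ⟩
    k + (k + k + (length as + length as + (length bs + length bs))) + k
      ≤⟨ +-monoˡ-≤ k (+-monoʳ-≤ k (+-monoʳ-≤ (k + k) (+-monoʳ-≤ (length as + length as)
           (+-mono-≤ balanced balanced)))) ⟩
    k + (k + k + (length as + length as + (length as + length as))) + k
      ≡⟨ four k (length as) ⟩
    4 * k + 4 * length as
      ≤⟨ large ⟩
    n ∎
    where
    open ≤-Reasoning
    four : ∀ a b → a + (a + a + (b + b + (b + b))) + a ≡ 4 * a + 4 * b
    four = solve-∀

  first = fresh k touched (≤-trans (+-monoˡ-≤ k (m≤n+m _ k)) room)
  ys = proj₁ first
  |ys| = proj₁ (proj₂ (proj₂ first))

  second = fresh k (ys ++ touched)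
    (≤-trans (≤-reflexive (cong (_+ k) (trans (length-++ ys) (cong (_+ length touched) |ys|)))) room)
  zs = proj₁ second

  new : ∀ {v} → v ∈ ys ++ zs → v ∉ touched
  new v∈ with ∈-++⁻ ys v∈
  ... | inj₁ v∈ys = proj₂ (proj₂ (proj₂ first)) _ v∈ys
  ... | inj₂ v∈zs = proj₂ (proj₂ (proj₂ second)) _ v∈zs ∘ ∈-++⁺ʳ ys

  R : Reserve hs cs as bs ys zs
  R = record
    { ys!       = proj₁ (proj₂ first)
    ; zs!       = proj₁ (proj₂ second)
    ; ys∩zs     = λ v∈ys v∈zs → proj₂ (proj₂ (proj₂ second)) _ v∈zs (∈-++⁺ˡ v∈ys)
    ; untouched = λ v∈ → new v∈ ∘ ∈-++⁺ˡ
                       , new v∈ ∘ ∈-++⁺ʳ (hs ++ cs) ∘ ∈-++⁺ˡ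
                       , new v∈ ∘ ∈-++⁺ʳ (hs ++ cs) ∘ ∈-++⁺ʳ (ends as)
    }

  module F = Completion |hs| |cs| |ys| (proj₁ (proj₂ (proj₂ second))) G D' R

  t≤forks : t ≤ length F.forks
  t≤forks = +-cancelʳ-≤ (length as) _ _ (≤-trans t≤ F.enough-forks)

-- With `s = size k j`, at least `4 * s` candidates yield a hub at which Enforcer has at most `s`
-- claims, then a pool of `2 * s`, then a star that keeps `s`. The bound on `length as + size k j`
-- pays for the moves of each star out of the drop in size.
hubs-survive : ∀ {k} → 1 ≤ k → 4 * k + 4 * size k k ≤ n →
  ∀ j t {hs as bs cs} → length hs + j ≡ k → size k j ≤ length cs →
  HubGraph hs as bs → Candidates {n} hs as cs →
  length as + size k j ≤ size k k → t + length as ≤ eBound n k → Survives k t as bs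
hubs-survive {n = n} {k} 1≤k large zero t {hs} {as} |hs| size≤ G D few t≤ =
  finish-survives t 1≤k (trans (sym (+-identityʳ _)) |hs|) (≤-trans k≤size size≤) G D
    (≤-trans (+-monoʳ-≤ (4 * k) (*-monoʳ-≤ 4 (≤-trans (m≤m+n (length as) (size k 0)) few))) large) t≤
  where
  k≤size : k ≤ size k 0
  k≤size = ≤-trans (n≤4^n k) (≤-trans (m≤m+n (4 ^ k) _) (m≤m*n _ 1))
hubs-survive {n = n} {k} 1≤k large (suc j) t {hs} {as} {bs} {cs} |hs|+j size≤ G D few t≤ =
  star-survives hs'≤k |hs'| (∈-++⁺ʳ hs (here refl)) s t pool-large G' P
    (record { cands! = [] ; cand∉ = λ _ () ; joined = λ _ () }) t≤
    λ t' G″ D″ |cs″| |as″| t'≤ → hubs-survive 1≤k large j t'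
      (trans (cong (_+ j) |hs'|) (trans (sym (+-suc _ j)) |hs|+j))
      (≤-reflexive (sym (trans |cs″| (+-identityʳ s)))) G″ D″
      (few' |as″|) t'≤
  where
  open HubGraph G hiding (safe)
  open Candidates D
  s = size k j

  4s≤ : 4 * s ≤ length cs
  4s≤ = ≤-trans (≤-reflexive (sym (size-suc k j))) size≤

  bs≤ : length bs ≤ size k k
  bs≤ = ≤-trans balanced (≤-trans (m≤m+n _ _) few)

  few-ends : length (ends bs) < length cs * suc s
  few-ends = begin-strict
    length (ends bs)         ≡⟨ length-ends bs ⟩
    length bs + length bs    ≤⟨ +-mono-≤ bs≤ bs≤ ⟩
    size k k + size k k      ≡⟨ size-square k ⟩
    size k 0 * size k 0      ≤⟨ *-mono-≤ (≤-trans (size-0≤ k (suc j)) size≤) (size-0≤ k j) ⟩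
    length cs * s            <⟨ +-monoˡ-< (length cs * s) (≤-trans (1≤size k (suc j)) size≤) ⟩
    length cs + length cs * s ≡⟨ *-suc (length cs) s ⟨
    length cs * suc s        ∎
    where open ≤-Reasoning

  found = rare cands! (ends bs) few-ends
  h = proj₁ found
  h∈ = proj₁ (proj₂ found)
  hs' = hs ++ h ∷ []
  removed = h ∷ nbrs h bs
  ps = cs ∖ removed

  |hs'| : length hs' ≡ suc (length hs)
  |hs'| = trans (length-++ hs) (+-comm _ 1)

  hs'≤k : length hs' ≤ k
  hs'≤k = ≤-trans (≤-reflexive |hs'|)
    (≤-trans (s≤s (m≤m+n _ j)) (≤-reflexive (trans (sym (+-suc _ j)) |hs|+j)))

  G' : HubGraph hs' as bs
  G' = add-hub (cand∉ h h∈) (joined h h∈) G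

  -- Removing `h` and its neighbours in `bs` costs at most `1 + s`, and `1 ≤ s` turns this into
  -- `s + s`.
  pool-large : 2 * s ≤ length ps
  pool-large = +-cancelˡ-≤ (s + s) _ _ (begin
    s + s + 2 * s                  ≡⟨ four s ⟩
    4 * s                          ≤⟨ 4s≤ ⟩
    length cs                      ≤⟨ length-∖ removed cands! ⟩
    suc (length (nbrs h bs)) + length ps
                                   ≤⟨ +-monoˡ-≤ (length ps) (+-mono-≤ (1≤size k j)
                                        (≤-trans (≤-reflexive (length-nbrs h bs)) (proj₂ (proj₂ found)))) ⟩
    s + s + length ps              ∎)
    where
    open ≤-Reasoning
    four : ∀ a → a + a + 2 * a ≡ 4 * a
    four = solve-∀

  -- The star takes `s` moves while the size drops from `4 * s` to `s`.
  few' : ∀ {m} → m ≡ s + length as → m + s ≤ size k k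
  few' refl = begin
    s + length as + s      ≡⟨ cong (_+ s) (+-comm s (length as)) ⟩
    length as + s + s      ≡⟨ +-assoc (length as) s s ⟩
    length as + (s + s)    ≤⟨ +-monoʳ-≤ (length as) (+-monoʳ-≤ s (m≤m+n s _)) ⟩
    length as + 4 * s      ≡⟨ cong (length as +_) (size-suc k j) ⟨
    length as + size k (suc j) ≤⟨ few ⟩
    size k k               ∎
    where open ≤-Reasoning

  in-cs : ∀ {p} → p ∈ ps → p ∈ cs
  in-cs p∈ = proj₁ (∈-∖⁻ cs removed p∈)
  kept : ∀ {p} → p ∈ ps → p ∉ removed
  kept p∈ = proj₂ (∈-∖⁻ cs removed p∈)

  -- Every claim of Avoider so far has its lower end in `hs`, which contains neither `p` nor `h`.
  no-edge : ∀ {p} → p ∈ ps → ¬ Any ((p , h) ∼_) as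
  no-edge {p} p∈ found = go order found
    where
    go : ∀ {qs} → All (λ q → proj₂ q ∈ hs × position hs (proj₂ q) < position hs (proj₁ q)) qs →
      ¬ Any ((p , h) ∼_) qs
    go ((u∈ , _) ∷ _) (here (inj₁ (_ , refl))) = cand∉ h h∈ u∈
    go ((u∈ , _) ∷ _) (here (inj₂ (refl , _))) = cand∉ p (in-cs p∈) u∈
    go (_ ∷ order)    (there found)            = go order found

  P : Pool hs' h (length hs) as bs ps
  P = record
    { pool!   = ∖-unique removed cands!
    ; pool∉   = λ p p∈ → [ cand∉ p (in-cs p∈) , (λ { (here p≡h) → kept p∈ (here p≡h) }) ]′ ∘ ∈-++⁻ hs
    ; waiting = λ p p∈ → joined p (in-cs p∈)
    ; open-as = λ p → no-edge
    ; open-bs = λ p p∈ found → kept p∈ (there (∈-nbrs⁺ (Any-∼-resp ∼-flip found)))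
    }

-- Numerical bounds and the conclusion

C2≤square : ∀ m → m C 2 ≤ m * m
C2≤square zero    = z≤n
C2≤square (suc m) = begin
  suc m C 2          ≡⟨ suc-C2 m ⟩
  m C 2 + m          ≤⟨ +-monoˡ-≤ m (C2≤square m) ⟩
  m * m + m          ≤⟨ m≤m+n (m * m + m) (suc m) ⟩
  m * m + m + suc m  ≡⟨ expand m ⟩
  suc m * suc m      ∎
  where
  open ≤-Reasoning
  expand : ∀ a → a * a + a + suc a ≡ suc a * suc a
  expand = solve-∀

eBound-≤ : ∀ {n k} → k ≤ n → eBound n k ≤ n * k + n * k
eBound-≤ {n} {k} k≤n =
  +-mono-≤ (*-monoˡ-≤ k (m∸n≤m n k)) (≤-trans (C2≤square k) (*-monoˡ-≤ k k≤n))

-- Here `n = d + 2`. Since `eBound n k` is at most `2 * n * k`, the left side is at most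
-- `8 * n * k + 4`, which is less than `n * (8 * k + 5)`.
eBound-small : ∀ {k d} → 8 * k + 5 ≤ suc d → 4 * suc (eBound (suc (suc d)) k) < suc (suc d) * suc d
eBound-small {k} {d} k≪d = begin-strict
  4 * suc (eBound m k)            ≤⟨ *-monoʳ-≤ 4 (s≤s (eBound-≤ k≤m)) ⟩
  4 * suc (m * k + m * k)         ≡⟨ expand (m * k) ⟩
  8 * (m * k) + 4 * 1             <⟨ +-monoʳ-< (8 * (m * k)) (*-mono-≤ {5} {5} {1} {m} ≤-refl (s≤s z≤n)) ⟩
  8 * (m * k) + 5 * m             ≡⟨ factor m k ⟩
  m * (8 * k + 5)                 ≤⟨ *-monoʳ-≤ m k≪d ⟩
  m * suc d                       ∎
  where
  open ≤-Reasoning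
  m = suc (suc d)
  k≤m : k ≤ m
  k≤m = ≤-trans (≤-trans (m≤n*m k 8) (m≤m+n (8 * k) 5)) (≤-trans k≪d (n≤1+n _))
  expand : ∀ a → 4 * suc (a + a) ≡ 8 * a + 4 * 1
  expand = solve-∀
  factor : ∀ a b → 8 * (a * b) + 5 * a ≡ a * (8 * b + 5)
  factor = solve-∀

-- The left side, which suffices for both players' strategies, equals `2 ^ (4 + 4 * k)`. As `1 ≤ k`,
-- the summand 4 is absorbed into `4 * k`; hence the multiple 8 at which `LittleOLog` is applied.
exponent-room : ∀ k → 1 ≤ k → 16 * (4 ^ k * 4 ^ k) ≤ 2 ^ (8 * k)
exponent-room k 1≤k = begin
  16 * (4 ^ k * 4 ^ k)      ≡⟨ cong (16 *_) (^-distribˡ-+-* 4 k k) ⟨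
  2 ^ 4 * 4 ^ (k + k)       ≡⟨ cong (2 ^ 4 *_) (^-*-assoc 2 2 (k + k)) ⟩
  2 ^ 4 * 2 ^ (2 * (k + k)) ≡⟨ ^-distribˡ-+-* 2 4 (2 * (k + k)) ⟨
  2 ^ (4 + 2 * (k + k))     ≤⟨ ^-monoʳ-≤ 2 (+-monoˡ-≤ (2 * (k + k)) (*-monoʳ-≤ 4 1≤k)) ⟩
  2 ^ (4 * k + 2 * (k + k)) ≡⟨ cong (2 ^_) (eight k) ⟩
  2 ^ (8 * k)               ∎
  where
  open ≤-Reasoning
  eight : ∀ a → 4 * a + 2 * (a + a) ≡ 8 * a
  eight = solve-∀

module _ {n k : ℕ} (1≤k : 1 ≤ k) (large : 16 * (4 ^ k * 4 ^ k) ≤ n) where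

  private
    X = 4 ^ k * 4 ^ k

    1≤X : 1 ≤ X
    1≤X = *-mono-≤ {1} {4 ^ k} {1} {4 ^ k} (m^n>0 4 k) (m^n>0 4 k)

    k≤X : k ≤ X
    k≤X = ≤-trans (≤-reflexive (sym (*-identityʳ k)))
      (*-mono-≤ {k} {4 ^ k} {1} {4 ^ k} (n≤4^n k) (m^n>0 4 k))

  phases-fit : 4 * k + 4 * size k k ≤ n
  phases-fit = begin
    4 * k + 4 * size k k      ≤⟨ +-monoˡ-≤ (4 * size k k) (*-monoʳ-≤ 4 k≤X) ⟩
    4 * X + 4 * size k k      ≡⟨ twelve (4 ^ k) ⟩
    12 * X                    ≤⟨ *-monoˡ-≤ X (m≤m+n 12 4) ⟩
    16 * X                    ≤⟨ large ⟩
    n                         ∎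
    where
    open ≤-Reasoning
    twelve : ∀ a → 4 * (a * a) + 4 * (2 * a * a) ≡ 12 * (a * a)
    twelve = solve-∀

  board-fits : suc (8 * k + 5) ≤ n
  board-fits = begin
    suc (8 * k + 5)        ≡⟨ +-suc (8 * k) 5 ⟨
    8 * k + 6 * 1          ≤⟨ +-mono-≤ (*-monoʳ-≤ 8 k≤X) (*-monoʳ-≤ 6 1≤X) ⟩
    8 * X + 6 * X          ≡⟨ *-distribʳ-+ X 8 6 ⟨
    14 * X                 ≤⟨ *-monoˡ-≤ X (m≤m+n 14 2) ⟩
    16 * X                 ≤⟨ large ⟩
    n                      ∎
    where open ≤-Reasoning

enforcer-forces : ∀ {n k} → suc (8 * k + 5) ≤ n → Force (𝒟 n k) (eBound n k + 1) ∅ ∅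
enforcer-forces {suc zero}        {k} (s≤s 8k+5≤0) = contradiction (≤-trans (m≤n+m 5 (8 * k)) 8k+5≤0) λ ()
enforcer-forces {n@(suc (suc d))} {k} (s≤s 8k+5≤) =
  enforcer-wins d k≤n ≤-refl (eBound-small {k} 8k+5≤) (eBound n k + 1) {[]} {[]}
    [] (λ _ ()) (λ _ ()) (λ _ ()) refl (trans (+-identityʳ _) (+-comm (eBound n k) 1))
  where
  k≤n : k ≤ n
  k≤n = ≤-trans (≤-trans (m≤n*m k 8) (m≤m+n (8 * k) 5)) (≤-trans 8k+5≤ (n≤1+n _))

avoider-survives : ∀ {n k} → 1 ≤ k → 4 * k + 4 * size k k ≤ n →
  ∀ {s} → s ≤ eBound n k → Survives {n} k s [] []
avoider-survives {n} {k} 1≤k fits {s} s≤ =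
  -- Without hubs every vertex counts as joined to all of them, so any `size k k` vertices can start
  -- as candidates.
  let cs , cs! , |cs| , _ = fresh (size k k) [] size≤n in
  hubs-survive 1≤k fits k s refl (≤-reflexive (sym |cs|))
    (record { order = [] ; outdeg = λ _ → z≤n ; hubs! = [] ; clique = z≤n ; balanced = z≤n })
    (record { cands! = cs! ; cand∉ = λ _ _ () ; joined = λ _ _ → refl })
    ≤-refl (≤-trans (≤-reflexive (+-identityʳ s)) s≤)
  where
  size≤n : size k k ≤ n
  size≤n = ≤-trans (m≤n*m (size k k) 4) (≤-trans (m≤n+m _ (4 * k)) fits)

theorem3 : (k : ℕ → ℕ) → (∀ n → 1 ≤ k n) → LittleOLog k →
    ∃ λ N → ∀ n → N ≤ n → TauE≡ (𝒟 n (k n)) (eBound n (k n) + 1)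
theorem3 k 1≤k k=o[log] = proj₁ (k=o[log] 8) , λ n N≤n →
  let large = ≤-trans (exponent-room (k n) (1≤k n)) (proj₂ (k=o[log] 8) n N≤n) in
    enforcer-forces (board-fits (1≤k n) large)
  , λ s s< → avoider-survives (1≤k n) (phases-fit (1≤k n) large)
      (≤-pred (≤-trans s< (≤-reflexive (+-comm (eBound n (k n)) 1)))) ∅ ∅ (λ _ ()) (λ _ ())
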